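{- Let $G$ be a graph of order $n$ such that every component of $G$ and every component of its complement $\overline{G}$ has order at least $3$. If $n\notin\{13,14,16,17,20\}$, then $$\gamma_P(G)+\gamma_P(\overline{G})\le \left\lfloor\frac{n}{3}\right\rfloor+2,$$ and this bound is attained for arbitrarily large $n$ by $G=rK_3$, the disjoint union of $r$ copies of $K_3$, where $r\ge 2$. If $n\in\{13,14,16,17,20\}$, then $$\gamma_P(G)+\gamma_P(\overline{G})\le \left\lfloor\frac{n}{3}\right\rfloor+3.$$
   Context: All graphs are finite, simple, undirected, with nonempty vertex set; the order is the number of vertices. $N(v)$ is the set of neighbors of $v$, $N[v]=N(v)\cup\{v\}$, and $N[S]=\bigcup_{v\in S}N[v]$. For $S\subseteq V(G)$, define $PD(S)$ by: (1) start with $PD(S):=N[S]$; (2) while there exists $v\in PD(S)$ with $|N(v)\setminus PD(S)|=1$, set $PD(S):=PD(S)\cup N(v)$. $S$ is a power dominating set if $PD(S)=V(G)$ at the end of the process. The power domination number $\gamma_P(G)$ is the minimum cardinality of a power dominating set of $G$. A component is a maximal connected subgraph. -}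

module Defs where

open import Level using (0ℓ)
open import Data.Nat using (ℕ; _*_; _<_; _≤_; NonZero; >-nonZero; >-nonZero⁻¹; _≟_)
open import Data.Nat.Properties using (m*n≢0; <⇒≤; ≤-totalOrder)
open import Data.Nat.GeneralisedArithmetic using (fold)
open import Data.Bool using (true; false)
import Data.Bool.Properties as Bool
open import Data.Fin using (Fin; remQuot)
import Data.Fin.Properties as Fin
open import Data.Fin.Subset using (Subset; _∈_; _⊆_; _∪_; _─_; ⁅_⁆; ⋃; ⊤; ∣_∣; Nonempty)
open import Data.Fin.Subset.Properties using (_∈?_)
open import Data.List using (List; []; _∷_; _++_; map; filter; allFin)
open import Data.List.Extrema ≤-totalOrder using (min)
open import Data.Product using (∃; _×_; _,_; proj₁; proj₂)
import Data.Vec as Vec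
open import Data.Vec.Properties using (≡-dec)
open import Relation.Nullary using (¬_; Dec; yes; no; does; ¬?)
open import Relation.Nullary.Decidable using (_×-dec_)
open import Relation.Binary.Core using (Rel; _⇒_)
open import Relation.Binary.Definitions using (Decidable; Irreflexive; Symmetric)
open import Relation.Binary.Construct.Closure.ReflexiveTransitive using (Star)
open import Relation.Binary.PropositionalEquality using (_≡_; _≢_; refl; sym)

record Graph (n : ℕ) : Set₁ where
  infix 4 _~_ _~?_
  field
    nonempty : 0 < n
    _~_      : Rel (Fin n) 0ℓ
    _~?_     : Decidable _~_
    ~-sym    : Symmetric _~_
    ~-irrefl : Irreflexive _≡_ _~_

complement : ∀ {n} → Graph n → Graph n
complement G = record
  { nonempty = nonempty
  ; _~_      = λ u v → u ≢ v × ¬ u ~ v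
  ; _~?_     = λ u v → ¬? (u Fin.≟ v) ×-dec ¬? (u ~? v)
  ; ~-sym    = λ (u≢v , u≁v) → (λ v≡u → u≢v (sym v≡u)) , (λ v~u → u≁v (~-sym v~u))
  ; ~-irrefl = λ u≡v (u≢v , _) → u≢v u≡v
  }
  where open Graph G

-- A subgraph may omit edges of G between its vertices.
record Subgraph {n : ℕ} (G : Graph n) : Set₁ where
  open Graph G using (_~_)
  infix 4 _∼_ _∼?_
  field
    vertices : Subset n
    nonempty : Nonempty vertices
    _∼_      : Rel (Fin n) 0ℓ
    _∼?_     : Decidable _∼_
    ∼-sym    : Symmetric _∼_
    ∼⇒∈      : ∀ {u v} → u ∼ v → u ∈ vertices
    ∼⇒~      : _∼_ ⇒ _~_

  order : ℕ
  order = ∣ vertices ∣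

  Connected : Set
  Connected = ∀ {u v} → u ∈ vertices → v ∈ vertices → Star _∼_ u v

infix 4 _⊑_

_⊑_ : ∀ {n} {G : Graph n} → Subgraph G → Subgraph G → Set
H ⊑ K = H.vertices ⊆ K.vertices × (H._∼_ ⇒ K._∼_)
  where
  module H = Subgraph H
  module K = Subgraph K

IsComponent : ∀ {n} {G : Graph n} → Subgraph G → Set₁
IsComponent {G = G} H =
  Subgraph.Connected H × (∀ (K : Subgraph G) → Subgraph.Connected K → H ⊑ K → K ⊑ H)

EveryComponentHasOrder≥ : ∀ {n} → ℕ → Graph n → Set₁
EveryComponentHasOrder≥ k G = ∀ (H : Subgraph G) → IsComponent H → k ≤ Subgraph.order H

module _ {n : ℕ} (G : Graph n) where
  open Graph G

  N : Fin n → Subset n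
  N v = Vec.tabulate (λ u → does (v ~? u))

  N[_] : Fin n → Subset n
  N[ v ] = N v ∪ ⁅ v ⁆

  N[_]ₛ : Subset n → Subset n
  N[ S ]ₛ = ⋃ (map N[_] (filter (_∈? S) (allFin n)))

  Forces : Subset n → Fin n → Set
  Forces P v = v ∈ P × ∣ N v ─ P ∣ ≡ 1

  forcing? : ∀ P → Dec (∃ (Forces P))
  forcing? P = Fin.any? (λ v → (v ∈? P) ×-dec (∣ N v ─ P ∣ ≟ 1))

  -- One iteration of the while loop, choosing the least v that qualifies (the
  -- final set does not depend on the choices); the identity once none does.
  step : Subset n → Subset n
  step P with forcing? P
  ... | yes (v , _) = P ∪ N v
  ... | no _        = P

  -- An iteration that changes the set adds a vertex, so after n iterations
  -- the loop has ended.
  PD : Subset n → Subset n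
  PD S = fold N[ S ]ₛ step n

  IsPowerDominating : Subset n → Set
  IsPowerDominating S = PD S ≡ ⊤

  isPowerDominating? : ∀ S → Dec (IsPowerDominating S)
  isPowerDominating? S = ≡-dec Bool._≟_ (PD S) ⊤

allSubsets : ∀ n → List (Subset n)
allSubsets ℕ.zero    = Vec.[] ∷ []
allSubsets (ℕ.suc n) =
  map (true Vec.∷_) (allSubsets n) ++ map (false Vec.∷_) (allSubsets n)

-- The first argument of min is a default value, here harmless: the whole vertex
-- set is power dominating, of cardinality n.
γP : ∀ {n} → Graph n → ℕ
γP {n} G = min n (map ∣_∣ (filter (isPowerDominating? G) (allSubsets n)))

K : ∀ n → .{{NonZero n}} → Graph n
K n = record
  { nonempty = >-nonZero⁻¹ n
  ; _~_      = _≢_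
  ; _~?_     = λ u v → ¬? (u Fin.≟ v)
  ; ~-sym    = λ u≢v v≡u → u≢v (sym v≡u)
  ; ~-irrefl = λ u≡v u≢v → u≢v u≡v
  }

-- Vertex a of the i-th copy is the element `combine i a` of Fin (r * m).
copies : ∀ {m} r → .{{NonZero r}} → Graph m → Graph (r * m)
copies {m} r {{r≢0}} G = record
  { nonempty = >-nonZero⁻¹ (r * m) {{m*n≢0 r m {{r≢0}} {{>-nonZero nonempty}}}}
  ; _~_      = λ u v → copy u ≡ copy v × vertex u ~ vertex v
  ; _~?_     = λ u v → (copy u Fin.≟ copy v) ×-dec (vertex u ~? vertex v)
  ; ~-sym    = λ (i≡j , a~b) → sym i≡j , ~-sym a~b
  ; ~-irrefl = λ { refl (_ , a~a) → ~-irrefl refl a~a }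
  }
  where
  open Graph G

  copy : Fin (r * m) → Fin r
  copy u = proj₁ (remQuot m u)

  vertex : Fin (r * m) → Fin m
  vertex u = proj₂ (remQuot {r} m u)

rK₃ : ∀ r → 2 ≤ r → Graph (r * 3)
rK₃ r 2≤r = copies r {{>-nonZero (<⇒≤ 2≤r)}} (K 3)

exceptionalOrders : List ℕ
exceptionalOrders = 13 ∷ 14 ∷ 16 ∷ 17 ∷ 20 ∷ []

{-# OPTIONS --safe #-}
-- Write H for the complement of G, a for γP G and b for γP H.
--
-- If every component of G has order at least 3, then 3a ≤ n: among the power
-- dominating sets of vertices of degree at least 2, take a smallest one with
-- fewest isolated vertices. Each of its vertices has two private neighbours,
-- since otherwise it could be dropped or exchanged for a neighbour that it
-- shares with another vertex of the set. This settles the case min(a, b) ≤ 2.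
--
-- Otherwise write a = 3 + α, b = 3 + β. Fewer than b vertices always have a
-- common G-neighbour, as they do not dominate H. Covering greedily what one or
-- two vertices leave undominated in G bounds the H-degrees below by
-- 2 + (1 + α)(2 + β) and the H-codegrees by 2 + α(2 + β). Adding the degrees of
-- a vertex in G and H gives n ≥ 9 + 3(α + β) + 2αβ, which suffices unless
-- n = 17 or one of α, β, say β, is 0 and n = 9 + 3α + r with r ≤ 2. Then all
-- H-degrees are at most Δ = 4 + 2α + r, and counting the paths of length 2 from
-- a vertex gives (n - 1)(2 + 2α) ≤ Δ(Δ - 1), which fails except for n = 14 and
-- for α = 0, n ∈ {10, 11}. For n = 10 the count forces both degrees of a
-- vertex to be at least 5, but their sum is 9; for n = 11 it is tight, and the two vertices left undominated by a
-- pair are twins in G, which makes some codegree too small.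
module Submission where

open import Defs
open import Data.Nat using (ℕ; zero; suc; _+_; _*_; _∸_; _≤_; _<_; _/_; z≤n; s≤s; _≤?_)
open import Data.Nat.Properties as ℕ using (≤-trans; ≤-refl; ≤-reflexive; +-0-commutativeMonoid; module ≤-Reasoning)
open import Data.Nat.DivMod using (/-monoˡ-≤; m*n/n≡m)
open import Data.Nat.GeneralisedArithmetic using (fold)
open import Data.Nat.Tactic.RingSolver using (solve-∀)
open import Data.Bool using (true; false; if_then_else_)
open import Data.Fin using (Fin; zero; suc; punchIn; punchOut; fromℕ<; remQuot; combine)
import Data.Fin.Properties as Fin
open import Data.Fin.Subset as Sub using (Subset; _⊆_; _⊂_; _∪_; _∩_; _─_; _-_; ⁅_⁆; ⋃; ⊤; ∣_∣; Nonempty)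
open import Data.Fin.Subset.Properties as Sub using (_∈?_)
open import Data.List using ([]; _∷_; map; filter; allFin)
open import Data.List.Membership.Propositional using (_∈_; _∉_)
open import Data.List.Membership.Propositional.Properties as List using (∈-map⁺; ∈-++⁺ˡ; ∈-++⁺ʳ)
open import Data.List.Relation.Unary.Any using (here; there)
import Data.List.Relation.Unary.All as All
import Data.List.Relation.Unary.All.Properties as All
open import Data.List.Extrema ℕ.≤-totalOrder using (min≤xs; v≤min⁺)
import Data.Vec as Vec
open import Data.Vec.Properties using (lookup∘tabulate; []=⇒lookup; lookup⇒[]=)
open import Data.Product using (∃; _×_; _,_; proj₁; proj₂)
open import Data.Sum using (_⊎_; inj₁; inj₂; [_,_]′)
open import Function using (_∘_; id)
open import Relation.Nullary using (¬_; Dec; yes; no; does; contradiction; ¬?)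
open import Relation.Nullary.Decidable using (_×-dec_; _⊎-dec_; _→-dec_; dec-true; dec-false; decidable-stable)
open import Relation.Unary using (Pred; Decidable)
open import Relation.Binary.Construct.Closure.ReflexiveTransitive as Star using (Star; ε; _◅_; _◅◅_)
open import Relation.Binary.PropositionalEquality
open import Level using (0ℓ)
open import Algebra.Properties.CommutativeMonoid.Sum +-0-commutativeMonoid using (sum; sum-remove; ∑-comm; sum-cong-≗)

-- Counting

indicator : {A : Set} → Dec A → ℕ
indicator A? = if does A? then 1 else 0

∣∣≡sum : ∀ {n} (p : Subset n) → ∣ p ∣ ≡ sum (λ i → indicator (i ∈? p))
∣∣≡sum Vec.[]            = refl
∣∣≡sum (true  Vec.∷ p) = cong suc (∣∣≡sum p)
∣∣≡sum (false Vec.∷ p) = ∣∣≡sum p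

⟪_⟫ : ∀ {n} {P : Pred (Fin n) 0ℓ} → Decidable P → Subset n
⟪ P? ⟫ = Vec.tabulate (λ i → does (P? i))

module _ {n : ℕ} {P : Pred (Fin n) 0ℓ} (P? : Decidable P) where

  ∈⟪⟫⁺ : ∀ {i} → P i → i Sub.∈ ⟪ P? ⟫
  ∈⟪⟫⁺ {i} p = lookup⇒[]= i ⟪ P? ⟫ (trans (lookup∘tabulate _ i) (dec-true (P? i) p))

  ∈⟪⟫⁻ : ∀ {i} → i Sub.∈ ⟪ P? ⟫ → P i
  ∈⟪⟫⁻ {i} i∈ with P? i | trans (sym (lookup∘tabulate (λ j → does (P? j)) i)) ([]=⇒lookup i∈)
  ... | yes p | _ = p
  ... | no _  | ()

  ∣⟪⟫∣≡sum : ∣ ⟪ P? ⟫ ∣ ≡ sum (λ i → indicator (P? i))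
  ∣⟪⟫∣≡sum = trans (∣∣≡sum ⟪ P? ⟫) (sum-cong-≗ λ i → lemma i)
    where
    lemma : ∀ i → indicator (i ∈? ⟪ P? ⟫) ≡ indicator (P? i)
    lemma i with P? i
    ... | yes p = cong (if_then 1 else 0) (dec-true (i ∈? ⟪ P? ⟫) (∈⟪⟫⁺ p))
    ... | no ¬p = cong (if_then 1 else 0) (dec-false (i ∈? ⟪ P? ⟫) (¬p ∘ ∈⟪⟫⁻))

sum-mono : ∀ {n} {f g : Fin n → ℕ} → (∀ i → f i ≤ g i) → sum f ≤ sum g
sum-mono {zero}  f≤g = z≤n
sum-mono {suc n} f≤g = ℕ.+-mono-≤ (f≤g zero) (sum-mono (f≤g ∘ suc))

*-sum : ∀ {n} c (f : Fin n → ℕ) → sum f * c ≡ sum (λ i → f i * c)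
*-sum {zero}  c f = refl
*-sum {suc n} c f = trans (ℕ.*-distribʳ-+ c (f zero) _) (cong (f zero * c +_) (*-sum c (f ∘ suc)))

module _ {n : ℕ} (p : Subset n) (c : ℕ) {f : Fin n → ℕ} where

  ∣p∣*c≡sum : ∣ p ∣ * c ≡ sum (λ i → indicator (i ∈? p) * c)
  ∣p∣*c≡sum = trans (cong (_* c) (∣∣≡sum p)) (*-sum c (λ i → indicator (i ∈? p)))

  ∣p∣*c≤sum : (∀ {i} → i Sub.∈ p → c ≤ f i) → ∣ p ∣ * c ≤ sum f
  ∣p∣*c≤sum c≤f = ≤-trans (≤-reflexive ∣p∣*c≡sum) (sum-mono lemma)
    where
    lemma : ∀ i → indicator (i ∈? p) * c ≤ f i
    lemma i with i ∈? p
    ... | yes i∈p = ≤-trans (≤-reflexive (ℕ.*-identityˡ c)) (c≤f i∈p)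
    ... | no _    = z≤n

  sum≤∣p∣*c : (∀ i → f i ≤ c) → (∀ {i} → 0 < f i → i Sub.∈ p) → sum f ≤ ∣ p ∣ * c
  sum≤∣p∣*c f≤c supp = ≤-trans (sum-mono lemma) (≤-reflexive (sym ∣p∣*c≡sum))
    where
    lemma : ∀ i → f i ≤ indicator (i ∈? p) * c
    lemma i with i ∈? p
    ... | yes _   = ≤-trans (f≤c i) (≤-reflexive (sym (ℕ.*-identityˡ c)))
    ... | no  i∉p = ℕ.≮⇒≥ (i∉p ∘ supp)

double-count : ∀ {m n} {R : Fin m → Fin n → Set} (R? : ∀ i j → Dec (R i j)) →
  sum (λ i → ∣ ⟪ R? i ⟫ ∣) ≡ sum (λ j → ∣ ⟪ (λ i → R? i j) ⟫ ∣)
double-count R? =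
  trans (sum-cong-≗ λ i → ∣⟪⟫∣≡sum (R? i))
  (trans (∑-comm (λ i j → indicator (R? i j)))
  (sum-cong-≗ λ j → sym (∣⟪⟫∣≡sum (λ i → R? i j))))

sum-≥-remove : ∀ {m} (f : Fin (suc m) → ℕ) i {c} → (∀ j → j ≢ i → c ≤ f j) → f i + m * c ≤ sum f
sum-≥-remove {m} f i {c} c≤f = ≤-trans
  (ℕ.+-monoʳ-≤ (f i) (≤-trans (≤-reflexive (cong (_* c) (sym (Sub.∣⊤∣≡n m))))
    (∣p∣*c≤sum ⊤ c (λ {j} _ → c≤f (punchIn i j) (Fin.punchInᵢ≢i i j)))))
  (≤-reflexive (sym (sum-remove f)))

module _ {n : ℕ} where

  ∣p∣>0⇒nonempty : ∀ {p : Subset n} → 0 < ∣ p ∣ → Nonempty p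
  ∣p∣>0⇒nonempty {p} 0<p with Sub.nonempty? p
  ... | yes ne = ne
  ... | no ¬ne = contradiction (≤-trans 0<p (≤-reflexive (trans (cong ∣_∣ (Sub.Empty-unique ¬ne)) (Sub.∣⊥∣≡0 n)))) λ ()

  ∣p∣>0 : ∀ {p : Subset n} {x} → x Sub.∈ p → 1 ≤ ∣ p ∣
  ∣p∣>0 x∈p = ≤-trans (s≤s z≤n) (Sub.x∈p⇒∣p-x∣<∣p∣ x∈p)

  ∣p∣>1 : ∀ {p : Subset n} {x y} → x Sub.∈ p → y Sub.∈ p → x ≢ y → 2 ≤ ∣ p ∣
  ∣p∣>1 x∈p y∈p x≢y = ≤-trans (s≤s (∣p∣>0 (Sub.x∈p∧x≢y⇒x∈p-y y∈p (x≢y ∘ sym)))) (Sub.x∈p⇒∣p-x∣<∣p∣ x∈p)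

  ∣p∣≤1⁻ : ∀ {p : Subset n} {x y} → ∣ p ∣ ≤ 1 → x Sub.∈ p → y Sub.∈ p → x ≡ y
  ∣p∣≤1⁻ {x = x} {y} p≤1 x∈p y∈p with x Fin.≟ y
  ... | yes x≡y = x≡y
  ... | no  x≢y = contradiction (≤-trans (∣p∣>1 x∈p y∈p x≢y) p≤1) λ { (s≤s ()) }

  ∣p∣≤1⁺ : ∀ {p : Subset n} → (∀ {x y} → x Sub.∈ p → y Sub.∈ p → x ≡ y) → ∣ p ∣ ≤ 1
  ∣p∣≤1⁺ {p} all≡ with Sub.nonempty? p
  ... | yes (x , x∈p) = ≤-trans (Sub.p⊆q⇒∣p∣≤∣q∣ λ y∈p → subst (Sub._∈ ⁅ x ⁆) (all≡ x∈p y∈p) (Sub.x∈⁅x⁆ x)) (≤-reflexive (Sub.∣⁅x⁆∣≡1 x))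
  ... | no ¬ne = ≤-trans (≤-reflexive (trans (cong ∣_∣ (Sub.Empty-unique ¬ne)) (Sub.∣⊥∣≡0 n))) z≤n

  ∣p∣<∣q∣⇒∃ : ∀ {p q : Subset n} → ∣ p ∣ < ∣ q ∣ → ∃ λ x → x Sub.∈ q × ¬ x Sub.∈ p
  ∣p∣<∣q∣⇒∃ {p} {q} p<q with Fin.any? (λ x → (x ∈? q) ×-dec ¬? (x ∈? p))
  ... | yes found = found
  ... | no none   = contradiction (Sub.p⊆q⇒∣p∣≤∣q∣ λ {x} x∈q → decidable-stable (x ∈? p) λ x∉p → none (x , x∈q , x∉p)) (ℕ.<⇒≱ p<q)

∣p∪q∣≤∣p∣+∣q∣ : ∀ {n} (p q : Subset n) → ∣ p ∪ q ∣ ≤ ∣ p ∣ + ∣ q ∣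
∣p∪q∣≤∣p∣+∣q∣ Vec.[] Vec.[] = z≤n
∣p∪q∣≤∣p∣+∣q∣ (true Vec.∷ p) (true Vec.∷ q) = s≤s (≤-trans (∣p∪q∣≤∣p∣+∣q∣ p q) (ℕ.+-monoʳ-≤ ∣ p ∣ (ℕ.n≤1+n _)))
∣p∪q∣≤∣p∣+∣q∣ (true Vec.∷ p) (false Vec.∷ q) = s≤s (∣p∪q∣≤∣p∣+∣q∣ p q)
∣p∪q∣≤∣p∣+∣q∣ (false Vec.∷ p) (true Vec.∷ q) = ≤-trans (s≤s (∣p∪q∣≤∣p∣+∣q∣ p q)) (≤-reflexive (sym (ℕ.+-suc ∣ p ∣ ∣ q ∣)))
∣p∪q∣≤∣p∣+∣q∣ (false Vec.∷ p) (false Vec.∷ q) = ∣p∪q∣≤∣p∣+∣q∣ p q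

disjoint⇒∣p∣+∣q∣≤∣p∪q∣ : ∀ {n} (p q : Subset n) → (∀ {x} → x Sub.∈ p → ¬ x Sub.∈ q) → ∣ p ∣ + ∣ q ∣ ≤ ∣ p ∪ q ∣
disjoint⇒∣p∣+∣q∣≤∣p∪q∣ Vec.[] Vec.[] _ = z≤n
disjoint⇒∣p∣+∣q∣≤∣p∪q∣ (true Vec.∷ p) (true Vec.∷ q) dis = contradiction Vec.here (dis Vec.here)
disjoint⇒∣p∣+∣q∣≤∣p∪q∣ (true Vec.∷ p) (false Vec.∷ q) dis = s≤s (disjoint⇒∣p∣+∣q∣≤∣p∪q∣ p q λ a b → dis (Vec.there a) (Vec.there b))
disjoint⇒∣p∣+∣q∣≤∣p∪q∣ (false Vec.∷ p) (true Vec.∷ q) dis = ≤-trans (≤-reflexive (ℕ.+-suc ∣ p ∣ ∣ q ∣)) (s≤s (disjoint⇒∣p∣+∣q∣≤∣p∪q∣ p q λ a b → dis (Vec.there a) (Vec.there b)))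
disjoint⇒∣p∣+∣q∣≤∣p∪q∣ (false Vec.∷ p) (false Vec.∷ q) dis = disjoint⇒∣p∣+∣q∣≤∣p∪q∣ p q λ a b → dis (Vec.there a) (Vec.there b)

x∈p─q⇒x∉q : ∀ {n} (p q : Subset n) {x} → x Sub.∈ p ─ q → ¬ x Sub.∈ q
x∈p─q⇒x∉q (_ Vec.∷ p) (true Vec.∷ q) () Vec.here
x∈p─q⇒x∉q (_ Vec.∷ p) (_ Vec.∷ q) (Vec.there a) (Vec.there b) = x∈p─q⇒x∉q p q a b

x∈p-y⇒x≢y : ∀ {n} (p : Subset n) y {x} → x Sub.∈ p - y → x ≢ y
x∈p-y⇒x≢y p y x∈ refl = x∈p─q⇒x∉q p ⁅ y ⁆ x∈ (Sub.x∈⁅x⁆ y)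

-- Takes the first `k` elements of `p`, or all of `p` if it has fewer; hence the inequalities and
-- the truncated subtraction.
split-off : ∀ {n} (p : Subset n) k → ∃ λ q → q ⊆ p × ∣ q ∣ ≤ k × ∣ p ─ q ∣ ≤ ∣ p ∣ ∸ k
split-off {n} p zero = Sub.⊥ , Sub.⊥⊆ , ≤-reflexive (Sub.∣⊥∣≡0 n) , ≤-reflexive (cong ∣_∣ (Sub.p─⊥≡p p))
split-off Vec.[] (suc k) = Vec.[] , id , z≤n , z≤n
split-off (true Vec.∷ p) (suc k) with split-off p k
... | q , q⊆p , q≤k , d = true Vec.∷ q , Sub.in⊆in q⊆p , s≤s q≤k , d
split-off (false Vec.∷ p) (suc k) with split-off p (suc k)
... | q , q⊆p , q≤k , d = false Vec.∷ q , Sub.out⊆ q⊆p , q≤k , d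

-- Double counting of the pairs with `f i ≡ j`: each `i` lies in a pair, each `j` in at most one,
-- and only `j` in `p` occur.
injection-≤ : ∀ {m n} {p : Subset n} (f : Fin m → Fin n) → (∀ {i j} → f i ≡ f j → i ≡ j) → (∀ i → f i Sub.∈ p) → m ≤ ∣ p ∣
injection-≤ {m} {n} {p} f inj f∈p = subst₂ _≤_ (trans (ℕ.*-identityʳ _) (Sub.∣⊤∣≡n m)) (ℕ.*-identityʳ _)
  (≤-trans (∣p∣*c≤sum ⊤ 1 λ {i} _ → ∣p∣>0 (∈⟪⟫⁺ (R? i) refl))
  (≤-trans (≤-reflexive (double-count R?))
  (sum≤∣p∣*c p 1
    (λ j → ∣p∣≤1⁺ λ {x} {y} x∈ y∈ → inj (trans (∈⟪⟫⁻ (λ i → R? i j) x∈) (sym (∈⟪⟫⁻ (λ i → R? i j) y∈))))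
    λ {j} 0< → let i , i∈ = ∣p∣>0⇒nonempty 0< in subst (Sub._∈ p) (∈⟪⟫⁻ (λ i → R? i j) i∈) (f∈p i))))
  where
  R? : ∀ i j → Dec (f i ≡ j)
  R? i j = f i Fin.≟ j

-- Power domination through forcing-closed sets

module _ {n : ℕ} (G : Graph n) where
  open Graph G

  ∈N⁺ : ∀ {u v} → v ~ u → u Sub.∈ N G v
  ∈N⁺ {_} {v} = ∈⟪⟫⁺ (v ~?_)

  ∈N⁻ : ∀ {u v} → u Sub.∈ N G v → v ~ u
  ∈N⁻ {_} {v} = ∈⟪⟫⁻ (v ~?_)

  -- Stability under the forcing rule, phrased without cardinalities. `PD G S` is the least such set
  -- containing `N[ G ]ₛ S`.
  ForcingClosed : Subset n → Set
  ForcingClosed Q = ∀ {v p} → v Sub.∈ Q → ¬ p Sub.∈ Q → v ~ p → ∃ λ p′ → p′ ≢ p × ¬ p′ Sub.∈ Q × v ~ p′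

  Dominates : Subset n → Fin n → Set
  Dominates S x = ∃ λ s → s Sub.∈ S × (s ≡ x ⊎ s ~ x)

  -- A neighbour of `v` outside `Q` would have a companion outside `Q`, so `v` would have two
  -- neighbours outside `P`.
  forces-within : ∀ {P Q v} → ForcingClosed Q → P ⊆ Q → Forces G P v → N G v ⊆ Q
  forces-within {P} {Q} {v} closed P⊆Q (v∈P , one) {x} x∈N with x ∈? Q
  ... | yes x∈Q = x∈Q
  ... | no  x∉Q = let p′ , p′≢x , p′∉Q , v~p′ = closed (P⊆Q v∈P) x∉Q (∈N⁻ x∈N) in
    contradiction (∣p∣≤1⁻ (≤-reflexive one)
      (Sub.x∈p∧x∉q⇒x∈p─q (∈N⁺ v~p′) (p′∉Q ∘ P⊆Q))
      (Sub.x∈p∧x∉q⇒x∈p─q x∈N (x∉Q ∘ P⊆Q))) p′≢x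

  step-within : ∀ {P Q} → ForcingClosed Q → P ⊆ Q → step G P ⊆ Q
  step-within {P} closed P⊆Q with forcing? G P
  ... | yes (v , f) = [ P⊆Q , forces-within closed P⊆Q f ]′ ∘ Sub.x∈p∪q⁻ P (N G v)
  ... | no _        = P⊆Q

  fold-within : ∀ {P Q} k → ForcingClosed Q → P ⊆ Q → fold P (step G) k ⊆ Q
  fold-within zero    closed P⊆Q = P⊆Q
  fold-within (suc k) closed P⊆Q = step-within closed (fold-within k closed P⊆Q)

  step-grows : ∀ P → (¬ ∃ (Forces G P) × step G P ≡ P) ⊎ (P ⊂ step G P)
  step-grows P with forcing? G P
  ... | no none = inj₁ (none , refl)
  ... | yes (v , v∈P , one) with ∣p∣>0⇒nonempty {p = N G v ─ P} (≤-reflexive (sym one))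
  ... | x , x∈ = inj₂ (Sub.p⊆p∪q (N G v) , x
    , Sub.x∈p∪q⁺ (inj₂ (Sub.p─q⊆p (N G v) P x∈)) , x∈p─q⇒x∉q (N G v) P x∈)

  -- An iteration either changes nothing, and then no later one does, or adds a vertex. For `k`
  -- equal to `n` the second alternative leaves no vertex outside.
  fold-stalls : ∀ P k → ¬ ∃ (Forces G (fold P (step G) k)) ⊎ k ≤ ∣ fold P (step G) k ∣
  fold-stalls P zero    = inj₂ z≤n
  fold-stalls P (suc k) with fold-stalls P k | step-grows (fold P (step G) k)
  ... | inj₁ none | inj₁ (_ , eq) = inj₁ (subst (λ Q → ¬ ∃ (Forces G Q)) (sym eq) none)
  ... | inj₂ _    | inj₁ (none , eq) = inj₁ (subst (λ Q → ¬ ∃ (Forces G Q)) (sym eq) none)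
  ... | inj₂ k≤   | inj₂ grows = inj₂ (≤-trans (s≤s k≤) (Sub.p⊂q⇒∣p∣<∣q∣ grows))
  ... | inj₁ none | inj₂ grows with forcing? G (fold P (step G) k)
  ... | yes f = contradiction f none
  ... | no _  = contradiction grows (Sub.⊂-irref refl)

  stalled⇒closed : ∀ {P} → ¬ ∃ (Forces G P) → ForcingClosed P
  stalled⇒closed {P} none {v} {p} v∈P p∉P v~p
    with Fin.any? (λ p′ → ¬? (p′ Fin.≟ p) ×-dec ¬? (p′ ∈? P) ×-dec (v ~? p′))
  ... | yes found = found
  ... | no ¬found = contradiction (v , v∈P , ℕ.≤-antisym (∣p∣≤1⁺ λ x∈ y∈ → trans (only x∈) (sym (only y∈)))
                                               (∣p∣>0 (Sub.x∈p∧x∉q⇒x∈p─q (∈N⁺ v~p) p∉P))) none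
    where
    only : ∀ {x} → x Sub.∈ N G v ─ P → x ≡ p
    only {x} x∈ = decidable-stable (x Fin.≟ p) λ x≢p →
      ¬found (x , x≢p , x∈p─q⇒x∉q (N G v) P x∈ , ∈N⁻ (Sub.p─q⊆p (N G v) P x∈))

  PD-closed : ∀ S → ForcingClosed (PD G S)
  PD-closed S with fold-stalls (N[ G ]ₛ S) n
  ... | inj₁ none = stalled⇒closed none
  ... | inj₂ n≤   = λ _ p∉ _ → contradiction
    (subst (_ Sub.∈_) (sym (Sub.∣p∣≡n⇒p≡⊤ (ℕ.≤-antisym (Sub.∣p∣≤n (PD G S)) n≤))) Sub.∈⊤) p∉

  ∈N[]ₛ⁺ : ∀ {S x} → Dominates S x → x Sub.∈ N[ G ]ₛ S
  ∈N[]ₛ⁺ {S} {x} (s , s∈S , s~x) = go (List.∈-filter⁺ (_∈? S) (List.∈-allFin s) s∈S)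
    where
    go : ∀ {ss} → s ∈ ss → x Sub.∈ ⋃ (map (N[_] G) ss)
    go (there s∈)  = Sub.x∈p∪q⁺ (inj₂ (go s∈))
    go (here refl) = Sub.x∈p∪q⁺ (inj₁ (Sub.x∈p∪q⁺ (closed-nbr s~x)))
      where
      closed-nbr : s ≡ x ⊎ s ~ x → x Sub.∈ N G s ⊎ x Sub.∈ ⁅ s ⁆
      closed-nbr (inj₁ refl) = inj₂ (Sub.x∈⁅x⁆ s)
      closed-nbr (inj₂ adj)  = inj₁ (∈N⁺ adj)

  ∈N[]ₛ⁻ : ∀ {S x} → x Sub.∈ N[ G ]ₛ S → Dominates S x
  ∈N[]ₛ⁻ {S} {x} x∈ = let s , s∈ , d = go (filter (_∈? S) (allFin n)) x∈ in
                      s , proj₂ (List.∈-filter⁻ (_∈? S) {xs = allFin n} s∈) , d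
    where
    go : ∀ ss → x Sub.∈ ⋃ (map (N[_] G) ss) → ∃ λ s → s ∈ ss × (s ≡ x ⊎ s ~ x)
    go [] x∈ = contradiction x∈ Sub.∉⊥
    go (s ∷ ss) x∈ with Sub.x∈p∪q⁻ (N[_] G s) (⋃ (map (N[_] G) ss)) x∈
    ... | inj₂ x∈′ = let t , t∈ , d = go ss x∈′ in t , there t∈ , d
    ... | inj₁ x∈′ with Sub.x∈p∪q⁻ (N G s) ⁅ s ⁆ x∈′
    ... | inj₁ x∈N = s , here refl , inj₂ (∈N⁻ x∈N)
    ... | inj₂ x∈s = s , here refl , inj₁ (sym (Sub.x∈⁅y⁆⇒x≡y s x∈s))

  P₀⊆PD : ∀ P k → P ⊆ fold P (step G) k
  P₀⊆PD P zero    = id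
  P₀⊆PD P (suc k) x∈ with step-grows (fold P (step G) k)
  ... | inj₁ (_ , eq) = subst (_ Sub.∈_) (sym eq) (P₀⊆PD P k x∈)
  ... | inj₂ (⊆ , _)  = ⊆ (P₀⊆PD P k x∈)

  -- With its converse below, this characterises power domination by forcing-closed sets; the later
  -- proofs never unfold the iteration.
  isPowerDominating⁺ : ∀ {S} →
    (∀ Q → ForcingClosed Q → (∀ {x} → Dominates S x → x Sub.∈ Q) → ∀ x → x Sub.∈ Q) →
    IsPowerDominating G S
  isPowerDominating⁺ {S} all = Sub.⊆-antisym Sub.⊆⊤
    λ {x} _ → all (PD G S) (PD-closed S) (P₀⊆PD (N[ G ]ₛ S) n ∘ ∈N[]ₛ⁺) x

  isPowerDominating⁻ : ∀ {S Q} → IsPowerDominating G S →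
    ForcingClosed Q → (∀ {x} → Dominates S x → x Sub.∈ Q) → ∀ x → x Sub.∈ Q
  isPowerDominating⁻ {S} {Q} PD≡⊤ closed dom x =
    fold-within n closed (dom ∘ ∈N[]ₛ⁻) (subst (x Sub.∈_) (sym PD≡⊤) Sub.∈⊤)

  dominating⇒powerDominating : ∀ {S} → (∀ x → Dominates S x) → IsPowerDominating G S
  dominating⇒powerDominating dom = isPowerDominating⁺ λ Q _ N⊆Q x → N⊆Q (dom x)

  γP≤ : ∀ {S} → IsPowerDominating G S → γP G ≤ ∣ S ∣
  γP≤ {S} pd = All.lookup (min≤xs n (map ∣_∣ pds)) (∈-map⁺ ∣_∣ (List.∈-filter⁺ (isPowerDominating? G) (complete S) pd))
    where
    pds = filter (isPowerDominating? G) (allSubsets n)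
    complete : ∀ {m} (T : Subset m) → T ∈ allSubsets m
    complete Vec.[]            = here refl
    complete (true  Vec.∷ T) = ∈-++⁺ˡ (∈-map⁺ (true Vec.∷_) (complete T))
    complete {suc m} (false Vec.∷ T) = ∈-++⁺ʳ (map (true Vec.∷_) (allSubsets m)) (∈-map⁺ (false Vec.∷_) (complete T))

  ≤γP : ∀ k → (∀ S → IsPowerDominating G S → k ≤ ∣ S ∣) → k ≤ γP G
  ≤γP k k≤ = v≤min⁺
    -- The default value `n` of `min` has to be bounded as well; the set of all vertices does it.
    (≤-trans (k≤ ⊤ (dominating⇒powerDominating λ x → x , Sub.∈⊤ , inj₁ refl)) (≤-reflexive (Sub.∣⊤∣≡n n)))
    (All.map⁺ (All.map (λ {S} → k≤ S) (All.all-filter (isPowerDominating? G) (allSubsets n))))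

-- The bound n/3

module _ {n : ℕ} (G : Graph n) where
  open Graph G using (_~_; _~?_; ~-sym; ~-irrefl)

  Branching : Fin n → Set
  Branching v = 2 ≤ ∣ N G v ∣

  PrivateNeighbor : Subset n → Fin n → Fin n → Set
  PrivateNeighbor S v u = ¬ u Sub.∈ S × v ~ u × ∀ s → s Sub.∈ S → s ~ u → s ≡ v

  privateNeighbor? : ∀ S v u → Dec (PrivateNeighbor S v u)
  privateNeighbor? S v u = ¬? (u ∈? S) ×-dec (v ~? u) ×-dec
    Fin.all? (λ s → (s ∈? S) →-dec (s ~? u) →-dec (s Fin.≟ v))

  priv : Subset n → Fin n → Subset n
  priv S v = ⟪ privateNeighbor? S v ⟫

  Isolated : Subset n → Fin n → Set
  Isolated S x = x Sub.∈ S × ∀ s → s Sub.∈ S → ¬ x ~ s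

  isolated? : ∀ S x → Dec (Isolated S x)
  isolated? S x = (x ∈? S) ×-dec Fin.all? (λ s → (s ∈? S) →-dec ¬? (x ~? s))

  isolated : Subset n → Subset n
  isolated S = ⟪ isolated? S ⟫

  -- Degree at least 2 guarantees that a vertex with at most one private neighbour has another
  -- neighbour to be exchanged for.
  Candidate : Subset n → Set
  Candidate S = IsPowerDominating G S × (∀ {s} → s Sub.∈ S → Branching s)

  -- Once v itself is observed, v forces its at most one private neighbour.
  exchange : ∀ {S S′ v} → S - v ⊆ S′ → Dominates G S′ v → ∣ priv S v ∣ ≤ 1 →
    IsPowerDominating G S → IsPowerDominating G S′
  exchange {S} {S′} {v} S-v⊆S′ dom-v few pd = isPowerDominating⁺ G λ Q closed N⊆Q →
    isPowerDominating⁻ G pd closed (within Q closed N⊆Q)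
    where
    module _ (Q : Subset n) (closed : ForcingClosed G Q) (N⊆Q : ∀ {x} → Dominates G S′ x → x Sub.∈ Q) where
      S-v⇒S′ : ∀ {s} → s Sub.∈ S → s ≢ v → s Sub.∈ S′
      S-v⇒S′ s∈S s≢v = S-v⊆S′ (Sub.x∈p∧x≢y⇒x∈p-y s∈S s≢v)

      missed⇒private : ∀ {x} → v ~ x → ¬ x Sub.∈ Q → x Sub.∈ priv S v
      missed⇒private {x} v~x x∉Q = ∈⟪⟫⁺ (privateNeighbor? S v)
        ( (λ x∈S → x∉Q (N⊆Q (x , S-v⇒S′ x∈S (λ x≡v → ~-irrefl (sym x≡v) v~x) , inj₁ refl)))
        , v~x
        , λ s s∈S s~x → decidable-stable (s Fin.≟ v) λ s≢v → x∉Q (N⊆Q (s , S-v⇒S′ s∈S s≢v , inj₂ s~x)))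

      N[v]⊆Q : ∀ {x} → v ~ x → x Sub.∈ Q
      N[v]⊆Q {x} v~x with x ∈? Q
      ... | yes x∈Q = x∈Q
      ... | no  x∉Q = let x′ , x′≢x , x′∉Q , v~x′ = closed (N⊆Q dom-v) x∉Q v~x in
        contradiction (∣p∣≤1⁻ few (missed⇒private v~x′ x′∉Q) (missed⇒private v~x x∉Q)) x′≢x

      within : ∀ {x} → Dominates G S x → x Sub.∈ Q
      within (s , s∈S , d) with s Fin.≟ v
      within (s , s∈S , d)         | no s≢v  = N⊆Q (s , S-v⇒S′ s∈S s≢v , d)
      within (s , s∈S , inj₁ refl) | yes refl = N⊆Q dom-v
      within (s , s∈S , inj₂ v~x)  | yes refl = N[v]⊆Q v~x

  improve : ∀ {S v} → Candidate S → v Sub.∈ S → ∣ priv S v ∣ ≤ 1 →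
    (∃ λ S′ → Candidate S′ × ∣ S′ ∣ < ∣ S ∣) ⊎
    (∃ λ S′ → Candidate S′ × ∣ S′ ∣ ≤ ∣ S ∣ × ∣ isolated S′ ∣ < ∣ isolated S ∣)
  improve {S} {v} (pd , branching) v∈S few with Fin.any? (λ s → (s ∈? S) ×-dec (v ~? s))
  ... | yes (s , s∈S , v~s) = inj₁
    ( S - v
    , ( exchange id (s , Sub.x∈p∧x≢y⇒x∈p-y s∈S (λ s≡v → ~-irrefl (sym s≡v) v~s) , inj₂ (~-sym v~s)) few pd
      , branching ∘ Sub.p─q⊆p S ⁅ v ⁆ )
    , Sub.x∈p⇒∣p-x∣<∣p∣ v∈S )
  ... | no alone with ∣p∣<∣q∣⇒∃ {p = priv S v} {q = N G v} (≤-trans (s≤s few) (branching v∈S))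
  ... | u , u∈N , u∉priv with Fin.any? (λ s → (s ∈? S) ×-dec (s ~? u) ×-dec ¬? (s Fin.≟ v))
  ... | no none = contradiction (∈⟪⟫⁺ (privateNeighbor? S v)
    ( (λ u∈S → alone (u , u∈S , ∈N⁻ G u∈N))
    , ∈N⁻ G u∈N
    , λ s s∈S s~u → decidable-stable (s Fin.≟ v) λ s≢v → none (s , s∈S , s~u , s≢v))) u∉priv
  ... | yes (s , s∈S , s~u , s≢v) = inj₂
    ( S′
    , ( exchange (Sub.p⊆p∪q ⁅ u ⁆) (u , u∈S′ , inj₂ (~-sym v~u)) few pd
      , [ branching ∘ Sub.p─q⊆p S ⁅ v ⁆
        , (λ x∈ → subst Branching (sym (Sub.x∈⁅y⁆⇒x≡y u x∈)) (∣p∣>1 (∈N⁺ G (~-sym v~u)) (∈N⁺ G (~-sym s~u)) (s≢v ∘ sym)))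
        ]′ ∘ Sub.x∈p∪q⁻ (S - v) ⁅ u ⁆ )
    , smaller
    , Sub.p⊂q⇒∣p∣<∣q∣ (fewer , v , ∈⟪⟫⁺ (isolated? S) (v∈S , λ s s∈S v~s → alone (s , s∈S , v~s))
                           , λ v∈ → v∉S′ (proj₁ (∈⟪⟫⁻ (isolated? S′) v∈))) )
    where
    S′ : Subset n
    S′ = (S - v) ∪ ⁅ u ⁆

    v~u : v ~ u
    v~u = ∈N⁻ G u∈N

    u∈S′ : u Sub.∈ S′
    u∈S′ = Sub.x∈p∪q⁺ (inj₂ (Sub.x∈⁅x⁆ u))

    S-v⇒S′ : ∀ {s} → s Sub.∈ S → s ≢ v → s Sub.∈ S′
    S-v⇒S′ s∈S s≢v = Sub.x∈p∪q⁺ (inj₁ (Sub.x∈p∧x≢y⇒x∈p-y s∈S s≢v))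

    smaller : ∣ S′ ∣ ≤ ∣ S ∣
    smaller = ≤-trans (∣p∪q∣≤∣p∣+∣q∣ (S - v) ⁅ u ⁆)
      (≤-trans (≤-reflexive (trans (cong (∣ S - v ∣ +_) (Sub.∣⁅x⁆∣≡1 u)) (ℕ.+-comm ∣ S - v ∣ 1)))
        (Sub.x∈p⇒∣p-x∣<∣p∣ v∈S))

    v∉S′ : ¬ v Sub.∈ S′
    v∉S′ v∈ with Sub.x∈p∪q⁻ (S - v) ⁅ u ⁆ v∈
    ... | inj₁ v∈S-v = x∈p-y⇒x≢y S v v∈S-v refl
    ... | inj₂ v∈u   = ~-irrefl (Sub.x∈⁅y⁆⇒x≡y u v∈u) v~u

    -- The new vertex `u` is not isolated because of `s`, and losing `v`, which had no neighbour in
    -- `S`, isolates no other vertex.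
    fewer : isolated S′ ⊆ isolated S
    fewer {x} x∈ with ∈⟪⟫⁻ (isolated? S′) x∈
    ... | x∈S′ , lonely with Sub.x∈p∪q⁻ (S - v) ⁅ u ⁆ x∈S′
    ... | inj₂ x∈u = contradiction (subst (_~ s) (sym (Sub.x∈⁅y⁆⇒x≡y u x∈u)) (~-sym s~u)) (lonely s (S-v⇒S′ s∈S s≢v))
    ... | inj₁ x∈S-v = ∈⟪⟫⁺ (isolated? S) (x∈S , still)
      where
      x∈S : x Sub.∈ S
      x∈S = Sub.p─q⊆p S ⁅ v ⁆ x∈S-v

      still : ∀ t → t Sub.∈ S → ¬ x ~ t
      still t t∈S x~t with t Fin.≟ v
      ... | yes refl = alone (x , x∈S , ~-sym x~t)
      ... | no  t≢v  = lonely t (S-v⇒S′ t∈S t≢v) x~t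

  Spread : Subset n → Set
  Spread S = ∀ v → v Sub.∈ S → 2 ≤ ∣ priv S v ∣

  -- Lexicographic descent on `∣ S ∣` and `∣ isolated S ∣`, with `m` and `k` as fuel; when `∣ S ∣`
  -- drops, the second bound is reset to the trivial `n`.
  spread : ∀ m k S → ∣ S ∣ ≤ m → ∣ isolated S ∣ ≤ k → Candidate S →
    ∃ λ S′ → Candidate S′ × Spread S′
  spread m k S ≤m ≤k cand with Fin.any? (λ v → (v ∈? S) ×-dec (∣ priv S v ∣ ≤? 1))
  ... | no none = S , cand , λ v v∈S → ℕ.≰⇒> λ few → none (v , v∈S , few)
  ... | yes (v , v∈S , few) with improve cand v∈S few
  spread (suc m) k S ≤m ≤k cand | yes (v , v∈S , few) | inj₁ (S′ , cand′ , <S) =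
    spread m n S′ (ℕ.≤-pred (≤-trans <S ≤m)) (Sub.∣p∣≤n (isolated S′)) cand′
  spread zero    k S ≤m ≤k cand | yes (v , v∈S , few) | inj₁ (S′ , cand′ , <S) =
    contradiction (≤-trans <S ≤m) λ ()
  spread m (suc k) S ≤m ≤k cand | yes (v , v∈S , few) | inj₂ (S′ , cand′ , ≤S , <I) =
    spread m k S′ (≤-trans ≤S ≤m) (ℕ.≤-pred (≤-trans <I ≤k)) cand′
  spread m zero    S ≤m ≤k cand | yes (v , v∈S , few) | inj₂ (S′ , cand′ , ≤S , <I) =
    contradiction (≤-trans <I ≤k) λ ()

  -- The sets made of a vertex of `S` and its private neighbours are pairwise disjoint and have at
  -- least three elements each.
  spread⇒small : ∀ {S} → Spread S → ∣ S ∣ * 3 ≤ n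
  spread⇒small {S} two = begin
    ∣ S ∣ * 3                                     ≤⟨ ∣p∣*c≤sum S 3 three ⟩
    sum (λ v → ∣ ⟪ block? v ⟫ ∣)                  ≡⟨ double-count block? ⟩
    sum (λ u → ∣ ⟪ (λ v → block? v u) ⟫ ∣)        ≤⟨ sum≤∣p∣*c ⊤ 1 (λ u → ∣p∣≤1⁺ λ x∈ y∈ → owner
                                                      (∈⟪⟫⁻ (λ v → block? v u) x∈) (∈⟪⟫⁻ (λ v → block? v u) y∈)) (λ _ → Sub.∈⊤) ⟩
    ∣ ⊤ {n} ∣ * 1                                 ≡⟨ trans (ℕ.*-identityʳ _) (Sub.∣⊤∣≡n n) ⟩
    n                                             ∎
    where
    open ≤-Reasoning

    Block : Fin n → Fin n → Set
    Block v u = v Sub.∈ S × (u ≡ v ⊎ PrivateNeighbor S v u)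

    block? : ∀ v u → Dec (Block v u)
    block? v u = (v ∈? S) ×-dec ((u Fin.≟ v) ⊎-dec privateNeighbor? S v u)

    owner : ∀ {v w u} → Block v u → Block w u → v ≡ w
    owner (_ , inj₁ refl) (_ , inj₁ refl) = refl
    owner (v∈S , inj₁ refl) (_ , inj₂ (u∉S , _)) = contradiction v∈S u∉S
    owner (_ , inj₂ (u∉S , _)) (w∈S , inj₁ refl) = contradiction w∈S u∉S
    owner (v∈S , inj₂ (_ , v~u , _)) (_ , inj₂ (_ , _ , only)) = only _ v∈S v~u

    three : ∀ {v} → v Sub.∈ S → 3 ≤ ∣ ⟪ block? v ⟫ ∣
    three {v} v∈S = begin
      3                           ≤⟨ s≤s (two v v∈S) ⟩
      1 + ∣ priv S v ∣            ≡⟨ cong (_+ ∣ priv S v ∣) (sym (Sub.∣⁅x⁆∣≡1 v)) ⟩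
      ∣ ⁅ v ⁆ ∣ + ∣ priv S v ∣    ≤⟨ disjoint⇒∣p∣+∣q∣≤∣p∪q∣ ⁅ v ⁆ (priv S v) (λ x∈v x∈priv →
                                       proj₁ (∈⟪⟫⁻ (privateNeighbor? S v) x∈priv) (subst (Sub._∈ S) (sym (Sub.x∈⁅y⁆⇒x≡y v x∈v)) v∈S)) ⟩
      ∣ ⁅ v ⁆ ∪ priv S v ∣        ≤⟨ Sub.p⊆q⇒∣p∣≤∣q∣ (λ x∈ → ∈⟪⟫⁺ (block? v) (v∈S ,
                                       [ inj₁ ∘ Sub.x∈⁅y⁆⇒x≡y v , inj₂ ∘ ∈⟪⟫⁻ (privateNeighbor? S v) ]′ (Sub.x∈p∪q⁻ ⁅ v ⁆ (priv S v) x∈))) ⟩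
      ∣ ⟪ block? v ⟫ ∣            ∎

  -- The descent starts from the set of all vertices of degree at least 2, which is dominating by
  -- hypothesis.
  branching⇒3*γP≤n : (∀ v → Branching v ⊎ ∃ λ p → v ~ p × Branching p) → γP G * 3 ≤ n
  branching⇒3*γP≤n core = let S , (pd , _) , two = spread n n hubs (Sub.∣p∣≤n hubs) (Sub.∣p∣≤n (isolated hubs)) candidate in
    ≤-trans (ℕ.*-monoˡ-≤ 3 (γP≤ G pd)) (spread⇒small two)
    where
    branching? : ∀ v → Dec (Branching v)
    branching? v = 2 ≤? ∣ N G v ∣

    hubs : Subset n
    hubs = ⟪ branching? ⟫

    candidate : Candidate hubs
    candidate = dominating⇒powerDominating G (λ x →
      [ (λ b → x , ∈⟪⟫⁺ branching? b , inj₁ refl)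
      , (λ (p , x~p , b) → p , ∈⟪⟫⁺ branching? b , inj₂ (~-sym x~p)) ]′ (core x)) , ∈⟪⟫⁻ branching?

-- Components

module _ {n : ℕ} (G : Graph n) where
  open Graph G using (_~_; _~?_; ~-sym; ~-irrefl)

  induced : (C : Subset n) → Nonempty C → Subgraph G
  induced C ne = record
    { vertices = C
    ; nonempty = ne
    ; _∼_ = λ u v → (u Sub.∈ C × v Sub.∈ C) × u ~ v
    ; _∼?_ = λ u v → ((u ∈? C) ×-dec (v ∈? C)) ×-dec (u ~? v)
    ; ∼-sym = λ ((u∈ , v∈) , u~v) → (v∈ , u∈) , ~-sym u~v
    ; ∼⇒∈ = λ ((u∈ , _) , _) → u∈
    ; ∼⇒~ = proj₂
    }

  -- A connected subgraph that contains `c` cannot leave `C`, as every edge of `G` from `C` stays in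
  -- `C`.
  closed⇒component : ∀ {C} (ne : Nonempty C) → (∀ {u v} → u Sub.∈ C → u ~ v → v Sub.∈ C) →
    Subgraph.Connected (induced C ne) → IsComponent (induced C ne)
  closed⇒component {C} (c , c∈C) closed conn = conn , λ K K-conn (C⊆K , _) →
    let within : Subgraph.vertices K ⊆ C
        within v∈K = walk K (K-conn (C⊆K c∈C) v∈K) c∈C
    in within , λ e → (within (Subgraph.∼⇒∈ K e) , within (Subgraph.∼⇒∈ K (Subgraph.∼-sym K e))) , Subgraph.∼⇒~ K e
    where
    walk : ∀ K {u v} → Star (Subgraph._∼_ K) u v → u Sub.∈ C → v Sub.∈ C
    walk K ε        u∈ = u∈
    walk K (e ◅ es) u∈ = walk K es (closed u∈ (Subgraph.∼⇒~ K e))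

  -- The subgraph induced on the vertices of `H` together with `v` is connected through `u`, so
  -- maximality puts `v` into `H`.
  component-closed : ∀ {H : Subgraph G} → IsComponent H → ∀ {u v} →
    u Sub.∈ Subgraph.vertices H → u ~ v → v Sub.∈ Subgraph.vertices H
  component-closed {H} (conn , maximal) {u} {v} u∈H u~v =
    proj₁ (maximal (induced C (u , H⊆C u∈H)) connected
      (H⊆C , λ e → (H⊆C (∼⇒∈ e) , H⊆C (∼⇒∈ (∼-sym e))) , ∼⇒~ e))
      (Sub.x∈p∪q⁺ (inj₂ (Sub.x∈⁅x⁆ v)))
    where
    open Subgraph H

    C : Subset n
    C = vertices ∪ ⁅ v ⁆

    H⊆C : vertices ⊆ C
    H⊆C = Sub.p⊆p∪q ⁅ v ⁆

    _≈_ : Fin n → Fin n → Set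
    _≈_ = Star (Subgraph._∼_ (induced C (u , H⊆C u∈H)))

    v∈C : v Sub.∈ C
    v∈C = Sub.x∈p∪q⁺ (inj₂ (Sub.x∈⁅x⁆ v))

    lift : ∀ {x y} → Star _∼_ x y → x ≈ y
    lift = Star.map λ e → (H⊆C (∼⇒∈ e) , H⊆C (∼⇒∈ (∼-sym e))) , ∼⇒~ e

    to-u : ∀ {x} → x Sub.∈ C → (x ≈ u) × (u ≈ x)
    to-u x∈C with Sub.x∈p∪q⁻ vertices ⁅ v ⁆ x∈C
    ... | inj₁ x∈H = lift (conn x∈H u∈H) , lift (conn u∈H x∈H)
    ... | inj₂ x∈v with Sub.x∈⁅y⁆⇒x≡y v x∈v
    ... | refl = ((v∈C , H⊆C u∈H) , ~-sym u~v) ◅ ε , ((H⊆C u∈H , v∈C) , u~v) ◅ ε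

    connected : Subgraph.Connected (induced C (u , H⊆C u∈H))
    connected x∈ y∈ = proj₁ (to-u x∈) ◅◅ proj₂ (to-u y∈)

  module _ (big : EveryComponentHasOrder≥ 3 G) where

    has-neighbor : ∀ v → ∃ (v ~_)
    has-neighbor v with Fin.any? (v ~?_)
    ... | yes found = found
    ... | no none = contradiction (≤-trans (big (induced ⁅ v ⁆ v∈) component) (≤-reflexive (Sub.∣⁅x⁆∣≡1 v))) λ { (s≤s ()) }
      where
      v∈ : Nonempty ⁅ v ⁆
      v∈ = v , Sub.x∈⁅x⁆ v

      component : IsComponent (induced ⁅ v ⁆ v∈)
      component = closed⇒component v∈
        (λ {x} {y} x∈ x~y → contradiction (y , subst (_~ y) (Sub.x∈⁅y⁆⇒x≡y v x∈) x~y) none)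
        λ {x} {y} x∈ y∈ → subst (Star _ x) (trans (Sub.x∈⁅y⁆⇒x≡y v x∈) (sym (Sub.x∈⁅y⁆⇒x≡y v y∈))) ε

    -- If both `v` and its neighbour `p` had degree 1, they would form a component of order 2.
    branching-or-next : ∀ v → Branching G v ⊎ ∃ λ p → v ~ p × Branching G p
    branching-or-next v with has-neighbor v
    ... | p , v~p with 2 ≤? ∣ N G v ∣ | 2 ≤? ∣ N G p ∣
    ... | yes b | _     = inj₁ b
    ... | no _  | yes b = inj₂ (p , v~p , b)
    ... | no ¬v | no ¬p = contradiction (≤-trans (big (induced C v∈) component)
      (≤-trans (∣p∪q∣≤∣p∣+∣q∣ ⁅ v ⁆ ⁅ p ⁆) (≤-reflexive (cong₂ _+_ (Sub.∣⁅x⁆∣≡1 v) (Sub.∣⁅x⁆∣≡1 p))))) λ { (s≤s (s≤s ())) }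
      where
      C : Subset n
      C = ⁅ v ⁆ ∪ ⁅ p ⁆

      ∈v : v Sub.∈ C
      ∈v = Sub.x∈p∪q⁺ (inj₁ (Sub.x∈⁅x⁆ v))

      ∈p : p Sub.∈ C
      ∈p = Sub.x∈p∪q⁺ (inj₂ (Sub.x∈⁅x⁆ p))

      v∈ : Nonempty C
      v∈ = v , ∈v

      which : ∀ {x} → x Sub.∈ C → x ≡ v ⊎ x ≡ p
      which x∈ = [ inj₁ ∘ Sub.x∈⁅y⁆⇒x≡y v , inj₂ ∘ Sub.x∈⁅y⁆⇒x≡y p ]′ (Sub.x∈p∪q⁻ ⁅ v ⁆ ⁅ p ⁆ x∈)

      closed : ∀ {x y} → x ≡ v ⊎ x ≡ p → x ~ y → y Sub.∈ C
      closed (inj₁ refl) x~y = subst (Sub._∈ C) (∣p∣≤1⁻ (ℕ.≤-pred (ℕ.≰⇒> ¬v)) (∈N⁺ G v~p) (∈N⁺ G x~y)) ∈p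
      closed (inj₂ refl) x~y = subst (Sub._∈ C) (∣p∣≤1⁻ (ℕ.≤-pred (ℕ.≰⇒> ¬p)) (∈N⁺ G (~-sym v~p)) (∈N⁺ G x~y)) ∈v

      conn : ∀ {x y} → x ≡ v ⊎ x ≡ p → y ≡ v ⊎ y ≡ p → Star (Subgraph._∼_ (induced C v∈)) x y
      conn (inj₁ refl) (inj₁ refl) = ε
      conn (inj₂ refl) (inj₂ refl) = ε
      conn (inj₁ refl) (inj₂ refl) = ((∈v , ∈p) , v~p) ◅ ε
      conn (inj₂ refl) (inj₁ refl) = ((∈p , ∈v) , ~-sym v~p) ◅ ε

      component : IsComponent (induced C v∈)
      component = closed⇒component v∈ (closed ∘ which) λ x∈ y∈ → conn (which x∈) (which y∈)

    3*γP≤n : γP G * 3 ≤ n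
    3*γP≤n = branching⇒3*γP≤n G branching-or-next

-- Complementary pairs

infix 4 _⋈_

-- A symmetric relation in place of `complement`: the double complement is not definitionally the
-- graph itself, and several lemmas are also used with `G` and `H` exchanged.
record _⋈_ {n} (G H : Graph n) : Set where
  private
    module G = Graph G
    module H = Graph H
  field
    apart : ∀ {u v} → u G.~ v → ¬ u H.~ v
    join  : ∀ {u v} → u ≢ v → ¬ u G.~ v → u H.~ v

open _⋈_

⋈-sym : ∀ {n} {G H : Graph n} → G ⋈ H → H ⋈ G
⋈-sym {G = G} c = record
  { apart = λ h g → apart c g h
  ; join  = λ {u} {v} u≢v ¬h → decidable-stable (Graph._~?_ G u v) (¬h ∘ join c u≢v)
  }

⋈-complement : ∀ {n} (G : Graph n) → G ⋈ complement G
⋈-complement G = record { apart = λ g (_ , ¬g) → ¬g g ; join = _,_ }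

∣⁅x⁆∪⁅y⁆∣≤2 : ∀ {n} (x y : Fin n) → ∣ ⁅ x ⁆ ∪ ⁅ y ⁆ ∣ ≤ 2
∣⁅x⁆∪⁅y⁆∣≤2 x y = ≤-trans (∣p∪q∣≤∣p∣+∣q∣ ⁅ x ⁆ ⁅ y ⁆) (≤-reflexive (cong₂ _+_ (Sub.∣⁅x⁆∣≡1 x) (Sub.∣⁅x⁆∣≡1 y)))

module _ {n : ℕ} {G H : Graph n} (c : G ⋈ H) where
  private
    module G = Graph G
    module H = Graph H

  -- The common H-neighbours of `v` and `w` are exactly the vertices that `v` and `w` leave
  -- undominated in `G`.
  codegree : Fin n → Fin n → ℕ
  codegree v w = ∣ N H v ∩ N H w ∣

  -- A set without common G-neighbour dominates H.
  common-neighbor : ∀ L → ∣ L ∣ < γP H → ∃ λ w → ∀ u → u Sub.∈ L → w G.~ u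
  common-neighbor L L<γ with Fin.any? (λ w → Fin.all? (λ u → (u ∈? L) →-dec (w G.~? u)))
  ... | yes found = found
  ... | no none = contradiction (γP≤ H (dominating⇒powerDominating H dom)) (ℕ.<⇒≱ L<γ)
    where
    dom : ∀ x → Dominates H L x
    dom x with Fin.any? (λ u → (u ∈? L) ×-dec ¬? (x G.~? u))
    ... | no all = contradiction (x , λ u u∈L → decidable-stable (x G.~? u) λ x≁u → all (u , u∈L , x≁u)) none
    ... | yes (u , u∈L , x≁u) with u Fin.≟ x
    ... | yes u≡x = u , u∈L , inj₁ u≡x
    ... | no  u≢x = u , u∈L , inj₂ (join c u≢x (x≁u ∘ G.~-sym))

  -- Each further vertex takes care of k vertices of T, and the last vertex of T is forced.
  greedy-cover : ∀ {k} t S T → 1 ≤ k → k < γP H → (∀ x → ¬ x Sub.∈ T → Dominates G S x) →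
    ∣ T ∣ ≤ 1 + t * k → γP G ≤ ∣ S ∣ + t
  greedy-cover zero S T 1≤k k<γ dom T≤1 = ≤-trans (γP≤ G (isPowerDominating⁺ G all)) (≤-reflexive (sym (ℕ.+-identityʳ ∣ S ∣)))
    where
    module _ (Q : Subset n) (closed : ForcingClosed G Q) (N⊆Q : ∀ {x} → Dominates G S x → x Sub.∈ Q) where
      missed∈T : ∀ {x} → ¬ x Sub.∈ Q → x Sub.∈ T
      missed∈T {x} x∉Q = decidable-stable (x ∈? T) (x∉Q ∘ N⊆Q ∘ dom x)

      all : ∀ x → x Sub.∈ Q
      all x with x ∈? Q
      ... | yes x∈Q = x∈Q
      -- `x` is the only missed vertex. One vertex does not dominate `H`, so `x` has a G-neighbour
      -- `z`, which is observed and forces `x`.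
      ... | no x∉Q with common-neighbor ⁅ x ⁆ (subst (_< γP H) (sym (Sub.∣⁅x⁆∣≡1 x)) (≤-trans (s≤s 1≤k) k<γ))
      ... | z , z~ = let p′ , p′≢x , p′∉Q , _ = closed z∈Q x∉Q z~x in
        contradiction (∣p∣≤1⁻ T≤1 (missed∈T p′∉Q) (missed∈T x∉Q)) p′≢x
        where
        z~x : z G.~ x
        z~x = z~ x (Sub.x∈⁅x⁆ x)

        z∈Q : z Sub.∈ Q
        z∈Q = decidable-stable (z ∈? Q) λ z∉Q → G.~-irrefl (∣p∣≤1⁻ T≤1 (missed∈T z∉Q) (missed∈T x∉Q)) z~x
  greedy-cover {k} (suc t) S T 1≤k k<γ dom T≤ with split-off T k
  ... | L , L⊆T , L≤k , rest with common-neighbor L (≤-trans (s≤s L≤k) k<γ)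
  ... | w , w~L = begin
    γP G              ≤⟨ greedy-cover t (S ∪ ⁅ w ⁆) (T ─ L) 1≤k k<γ dom′ fits ⟩
    ∣ S ∪ ⁅ w ⁆ ∣ + t  ≤⟨ ℕ.+-monoˡ-≤ t (≤-trans (∣p∪q∣≤∣p∣+∣q∣ S ⁅ w ⁆) (≤-reflexive (cong (∣ S ∣ +_) (Sub.∣⁅x⁆∣≡1 w)))) ⟩
    ∣ S ∣ + 1 + t     ≡⟨ ℕ.+-assoc ∣ S ∣ 1 t ⟩
    ∣ S ∣ + suc t     ∎
    where
    open ≤-Reasoning

    fits : ∣ T ─ L ∣ ≤ 1 + t * k
    fits = begin
      ∣ T ─ L ∣               ≤⟨ rest ⟩
      ∣ T ∣ ∸ k               ≤⟨ ℕ.∸-monoˡ-≤ k T≤ ⟩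
      1 + (k + t * k) ∸ k     ≡⟨ cong (_∸ k) (trans (sym (ℕ.+-suc k (t * k))) refl) ⟩
      k + (1 + t * k) ∸ k     ≡⟨ ℕ.m+n∸m≡n k (1 + t * k) ⟩
      1 + t * k               ∎

    dom′ : ∀ x → ¬ x Sub.∈ T ─ L → Dominates G (S ∪ ⁅ w ⁆) x
    dom′ x x∉ with x ∈? L
    ... | yes x∈L = w , Sub.x∈p∪q⁺ (inj₂ (Sub.x∈⁅x⁆ w)) , inj₂ (w~L x x∈L)
    ... | no  x∉L = let s , s∈S , d = dom x (λ x∈T → x∉ (Sub.x∈p∧x∉q⇒x∈p─q x∈T x∉L)) in
                    s , Sub.p⊆p∪q ⁅ w ⁆ s∈S , d

  outside-N⇒dominated : ∀ {v x} → ¬ x Sub.∈ N H v → v ≡ x ⊎ v G.~ x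
  outside-N⇒dominated {v} {x} x∉ with v Fin.≟ x
  ... | yes v≡x = inj₁ v≡x
  ... | no  v≢x = inj₂ (join (⋈-sym c) v≢x (x∉ ∘ ∈N⁺ H))

  degree-sum : ∀ v → ∣ N G v ∣ + ∣ N H v ∣ < n
  degree-sum v = begin-strict
    ∣ N G v ∣ + ∣ N H v ∣  ≤⟨ disjoint⇒∣p∣+∣q∣≤∣p∪q∣ (N G v) (N H v) (λ g h → apart c (∈N⁻ G g) (∈N⁻ H h)) ⟩
    ∣ N G v ∪ N H v ∣      ≤⟨ Sub.p⊆q⇒∣p∣≤∣q∣ (λ x∈ → Sub.x∈p∧x≢y⇒x∈p-y Sub.∈⊤ (proper x∈)) ⟩
    ∣ ⊤ - v ∣              <⟨ Sub.x∈p⇒∣p-x∣<∣p∣ (Sub.∈⊤ {x = v}) ⟩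
    ∣ ⊤ {n} ∣              ≡⟨ Sub.∣⊤∣≡n n ⟩
    n                      ∎
    where
    open ≤-Reasoning
    proper : ∀ {x} → x Sub.∈ N G v ∪ N H v → x ≢ v
    proper x∈ refl = [ G.~-irrefl refl ∘ ∈N⁻ G , H.~-irrefl refl ∘ ∈N⁻ H ]′ (Sub.x∈p∪q⁻ (N G v) (N H v) x∈)

  -- Counts the walks of length 2 from `v` in `H`, first by their end `w`, then by their middle `u`,
  -- which lies in `N H v` and allows at most `Δ` ends.
  sum-codegree : ∀ v {Δ} → (∀ u → ∣ N H u ∣ ≤ Δ) → sum (codegree v) ≤ ∣ N H v ∣ * Δ
  sum-codegree v {Δ} ≤Δ = begin
    sum (codegree v)                       ≤⟨ sum-mono (λ w → Sub.p⊆q⇒∣p∣≤∣q∣ (λ u∈ → ∈⟪⟫⁺ (path? w)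
                                                (let u∈v , u∈w = Sub.x∈p∩q⁻ (N H v) (N H w) u∈ in u∈v , H.~-sym (∈N⁻ H u∈w)))) ⟩
    sum (λ w → ∣ ⟪ path? w ⟫ ∣)            ≡⟨ double-count path? ⟩
    sum (λ u → ∣ ⟪ (λ w → path? w u) ⟫ ∣)  ≤⟨ sum≤∣p∣*c (N H v) Δ
                                                (λ u → ≤-trans (Sub.p⊆q⇒∣p∣≤∣q∣ (λ w∈ → ∈N⁺ H (proj₂ (∈⟪⟫⁻ (λ w → path? w u) w∈)))) (≤Δ u))
                                                (λ {u} 0< → let w , w∈ = ∣p∣>0⇒nonempty 0< in proj₁ (∈⟪⟫⁻ (λ w → path? w u) w∈)) ⟩
    ∣ N H v ∣ * Δ                          ∎
    where
    open ≤-Reasoning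
    path? : ∀ w u → Dec (u Sub.∈ N H v × u H.~ w)
    path? w u = (u ∈? N H v) ×-dec (u H.~? w)

  -- If {v, x} leaves exactly y and y′ undominated in G, then a vertex adjacent
  -- to just one of them would force it, and the other one would follow.
  twins : ∀ {v x y y′} → 2 < γP G → 1 < γP H → (∀ {u} → u Sub.∈ N H v ∩ N H x → u ≡ y ⊎ u ≡ y′) →
    ∀ {z} → z ≢ y → z G.~ y → z ≢ y′ → z G.~ y′
  twins {v} {x} {y} {y′} 2<γ 1<γ′ only {z} z≢y z~y z≢y′ = decidable-stable (z G.~? y′) λ z≁y′ →
    contradiction (≤-trans (γP≤ G (isPowerDominating⁺ G (all z≁y′))) (∣⁅x⁆∪⁅y⁆∣≤2 v x)) (ℕ.<⇒≱ 2<γ)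
    where
    S : Subset n
    S = ⁅ v ⁆ ∪ ⁅ x ⁆

    module _ (z≁y′ : ¬ z G.~ y′) (Q : Subset n) (closed : ForcingClosed G Q) (N⊆Q : ∀ {x} → Dominates G S x → x Sub.∈ Q) where
      missed : ∀ {u} → ¬ u Sub.∈ Q → u ≡ y ⊎ u ≡ y′
      missed {u} u∉Q = only (Sub.x∈p∩q⁺ (in-N v (Sub.x∈p∪q⁺ (inj₁ (Sub.x∈⁅x⁆ v))) , in-N x (Sub.x∈p∪q⁺ (inj₂ (Sub.x∈⁅x⁆ x)))))
        where
        in-N : ∀ s → s Sub.∈ S → u Sub.∈ N H s
        in-N s s∈S = decidable-stable (u ∈? N H s) λ u∉ → u∉Q (N⊆Q (s , s∈S , outside-N⇒dominated u∉))

      y∈Q : y Sub.∈ Q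
      y∈Q = decidable-stable (y ∈? Q) λ y∉Q →
        let p , p≢y , p∉Q , z~p = closed (decidable-stable (z ∈? Q) λ z∉Q → [ z≢y , z≢y′ ]′ (missed z∉Q)) y∉Q z~y in
        [ p≢y , (λ p≡y′ → z≁y′ (subst (z G.~_) p≡y′ z~p)) ]′ (missed p∉Q)

      missed′ : ∀ {u} → ¬ u Sub.∈ Q → u ≡ y′
      missed′ u∉Q = [ (λ { refl → contradiction y∈Q u∉Q }) , id ]′ (missed u∉Q)

      all : ∀ u → u Sub.∈ Q
      all u = decidable-stable (u ∈? Q) λ u∉Q →
        let t , t~ = common-neighbor ⁅ u ⁆ (subst (_< γP H) (sym (Sub.∣⁅x⁆∣≡1 u)) 1<γ′)
            t~u = t~ u (Sub.x∈⁅x⁆ u)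
            t∈Q = decidable-stable (t ∈? Q) λ t∉Q → G.~-irrefl (trans (missed′ t∉Q) (sym (missed′ u∉Q))) t~u
            p , p≢u , p∉Q , _ = closed t∈Q u∉Q t~u
        in p≢u (trans (missed′ p∉Q) (sym (missed′ u∉Q)))

  module _ {α β : ℕ} (γG : γP G ≡ 3 + α) (γH : γP H ≡ 3 + β) where

    private
      k<γ : 2 + β < γP H
      k<γ = ≤-reflexive (sym γH)

    -- Otherwise `v` and `1 + α` greedily chosen vertices, each covering up to `2 + β` of what `v`
    -- leaves undominated, would power dominate `G` with only `2 + α` vertices.
    degree-≥ : ∀ v → 2 + (1 + α) * (2 + β) ≤ ∣ N H v ∣
    degree-≥ v = ℕ.≰⇒> λ few → ℕ.<⇒≱ ≤-refl (≤-trans (≤-trans (≤-reflexive (sym γG))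
      (greedy-cover (1 + α) ⁅ v ⁆ (N H v) (s≤s z≤n) k<γ (λ x x∉ → v , Sub.x∈⁅x⁆ v , outside-N⇒dominated x∉) few))
      (≤-reflexive (cong (_+ suc α) (Sub.∣⁅x⁆∣≡1 v))))

    -- The same with two starting vertices, which leaves `α` greedy ones; `v` and `w` may coincide.
    codegree-≥ : ∀ v w → 2 + α * (2 + β) ≤ codegree v w
    codegree-≥ v w = ℕ.≰⇒> λ few → ℕ.<⇒≱ ≤-refl (≤-trans (≤-trans (≤-reflexive (sym γG))
      (greedy-cover α (⁅ v ⁆ ∪ ⁅ w ⁆) (N H v ∩ N H w) (s≤s z≤n) k<γ dom few))
      (ℕ.+-monoˡ-≤ α (∣⁅x⁆∪⁅y⁆∣≤2 v w)))
      where
      dom : ∀ x → ¬ x Sub.∈ N H v ∩ N H w → Dominates G (⁅ v ⁆ ∪ ⁅ w ⁆) x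
      dom x x∉ with x ∈? N H v
      ... | no x∉v = v , Sub.x∈p∪q⁺ (inj₁ (Sub.x∈⁅x⁆ v)) , outside-N⇒dominated x∉v
      ... | yes x∈v = w , Sub.x∈p∪q⁺ (inj₂ (Sub.x∈⁅x⁆ w)) , outside-N⇒dominated λ x∈w → x∉ (Sub.x∈p∩q⁺ (x∈v , x∈w))

-- Second-order counting

sum-≥-remove₂ : ∀ {m} (f : Fin (2 + m) → ℕ) {i w} → w ≢ i → ∀ {c} → (∀ j → j ≢ i → c ≤ f j) →
  f i + (f w + m * c) ≤ sum f
sum-≥-remove₂ {m} f {i} {w} w≢i {c} c≤f = begin
  f i + (f w + m * c)   ≡⟨ cong (λ j → f i + (f j + m * c)) (sym (Fin.punchIn-punchOut i≢w)) ⟩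
  f i + (f (punchIn i (punchOut i≢w)) + m * c)
                        ≤⟨ ℕ.+-monoʳ-≤ (f i) (sum-≥-remove (f ∘ punchIn i) (punchOut i≢w)
                             (λ j _ → c≤f (punchIn i j) (Fin.punchInᵢ≢i i j))) ⟩
  f i + sum (f ∘ punchIn i) ≡⟨ sym (sum-remove f) ⟩
  sum f                 ∎
  where
  open ≤-Reasoning
  i≢w : i ≢ w
  i≢w = w≢i ∘ sym

pair-elements : ∀ {n} {p : Subset n} → 2 ≤ ∣ p ∣ → ∣ p ∣ ≤ 2 →
  ∃ λ y → ∃ λ y′ → y Sub.∈ p × y′ Sub.∈ p × y′ ≢ y × (∀ {u} → u Sub.∈ p → u ≡ y ⊎ u ≡ y′)
pair-elements {n} {p} 2≤ ≤2 = let y , y∈ = ∣p∣>0⇒nonempty {p = p} (≤-trans (s≤s z≤n) 2≤) in go y y∈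
  where
  go : ∀ y → y Sub.∈ p → ∃ λ y → ∃ λ y′ → y Sub.∈ p × y′ Sub.∈ p × y′ ≢ y × (∀ {u} → u Sub.∈ p → u ≡ y ⊎ u ≡ y′)
  go y y∈ with ∣p∣<∣q∣⇒∃ {p = ⁅ y ⁆} {q = p} (≤-trans (s≤s (≤-reflexive (Sub.∣⁅x⁆∣≡1 y))) 2≤)
  ... | y′ , y′∈ , y′∉y = y , y′ , y∈ , y′∈ , Sub.x∉⁅y⁆⇒x≢y y′∉y , all
    where
    all : ∀ {u} → u Sub.∈ p → u ≡ y ⊎ u ≡ y′
    all {u} u∈ with u Fin.≟ y
    ... | yes u≡y = inj₁ u≡y
    ... | no  u≢y = inj₂ (∣p∣≤1⁻ (ℕ.≤-pred (≤-trans (Sub.x∈p⇒∣p-x∣<∣p∣ y∈) ≤2))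
                           (Sub.x∈p∧x≢y⇒x∈p-y u∈ u≢y) (Sub.x∈p∧x≢y⇒x∈p-y y′∈ (Sub.x∉⁅y⁆⇒x≢y y′∉y)))

codegree-self : ∀ {n} {G H : Graph n} (c : G ⋈ H) v → codegree c v v ≡ ∣ N H v ∣
codegree-self {H = H} c v = cong ∣_∣ (Sub.∩-idem (N H v))

module _ {m α : ℕ} {G H : Graph (suc m)} (c : G ⋈ H) (γG : γP G ≡ 3 + α) (γH : γP H ≡ 3) where

  -- The G-degree of `v` is at least `4 + α` by `degree-≥` with the graphs exchanged, and the two
  -- degrees of `v` add up to at most `m`.
  degree-≤ : ∀ {Δ} → m ≡ 4 + α + Δ → ∀ v → ∣ N H v ∣ ≤ Δ
  degree-≤ {Δ} refl v = ℕ.+-cancelˡ-≤ (4 + α) ∣ N H v ∣ Δ (begin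
    4 + α + ∣ N H v ∣            ≡⟨ cong (λ k → 4 + k + ∣ N H v ∣) (sym (ℕ.+-identityʳ α)) ⟩
    4 + (α + 0) + ∣ N H v ∣      ≤⟨ ℕ.+-monoˡ-≤ ∣ N H v ∣ (degree-≥ (⋈-sym c) γH γG v) ⟩
    ∣ N G v ∣ + ∣ N H v ∣        ≤⟨ ℕ.≤-pred (degree-sum c v) ⟩
    4 + α + Δ                    ∎)
    where open ≤-Reasoning

  -- Bounds the walks of length 2 from `v` below through the codegrees; those returning to `v`,
  -- `∣ N H v ∣` in number, cancel.
  second-moment : ∀ {δ} → (∀ u → ∣ N H u ∣ ≤ suc δ) → ∀ v → m * (2 + α * 2) ≤ ∣ N H v ∣ * δ
  second-moment {δ} ≤Δ v = ℕ.+-cancelˡ-≤ ∣ N H v ∣ _ _ (begin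
    ∣ N H v ∣ + m * (2 + α * 2)        ≡⟨ cong (_+ m * (2 + α * 2)) (sym (codegree-self c v)) ⟩
    codegree c v v + m * (2 + α * 2)   ≤⟨ sum-≥-remove (codegree c v) v (λ w _ → codegree-≥ c γG γH v w) ⟩
    sum (codegree c v)                 ≤⟨ sum-codegree c v ≤Δ ⟩
    ∣ N H v ∣ * suc δ                  ≡⟨ ℕ.*-suc ∣ N H v ∣ δ ⟩
    ∣ N H v ∣ + ∣ N H v ∣ * δ          ∎)
    where open ≤-Reasoning

  -- `suc δ` is the degree bound from `degree-≤`, and `suc k` is the margin by which the path count
  -- fails, so that the failure becomes a ring identity.
  dense-contradiction : ∀ {δ k} → m ≡ 5 + α + δ → m * (2 + α * 2) ≡ suc (suc δ * δ + k) → ¬ Fin (suc m)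
  dense-contradiction {δ} {k} m≡ eq v = ℕ.<⇒≱ (s≤s (ℕ.m≤m+n (suc δ * δ) k)) (begin
    suc (suc δ * δ + k)    ≡⟨ sym eq ⟩
    m * (2 + α * 2)        ≤⟨ second-moment ≤Δ v ⟩
    ∣ N H v ∣ * δ          ≤⟨ ℕ.*-monoˡ-≤ δ (≤Δ v) ⟩
    suc δ * δ              ∎)
    where
    open ≤-Reasoning
    ≤Δ : ∀ u → ∣ N H u ∣ ≤ suc δ
    ≤Δ = degree-≤ (trans m≡ (sym (ℕ.+-suc (4 + α) δ)))

-- All degrees are at most 5, so the path count reads 18 ≤ 4d for the degree d of `v`.
order-10-degree : ∀ {m} {G H : Graph (suc m)} (c : G ⋈ H) → γP G ≡ 3 → γP H ≡ 3 → m ≡ 9 → ∀ v → 5 ≤ ∣ N H v ∣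
order-10-degree {m} {H = H} c γG γH m≡9 v = ℕ.≰⇒> λ ≤4 → ℕ.<⇒≱ (ℕ.≤ᵇ⇒≤ 17 18 _) (begin
  9 * 2            ≡⟨ cong (_* 2) (sym m≡9) ⟩
  m * 2            ≤⟨ second-moment c γG γH {4} (degree-≤ c γG γH m≡9) v ⟩
  ∣ N H v ∣ * 4    ≤⟨ ℕ.*-monoˡ-≤ 4 ≤4 ⟩
  16               ∎)
  where open ≤-Reasoning

-- Order 11: equality in the path count

module _ {m : ℕ} {G H : Graph (2 + m)} (c : G ⋈ H) (γG : γP G ≡ 3) (γH : γP H ≡ 3) (m≡9 : m ≡ 9) where
  private
    module G = Graph G
    module H = Graph H

    2<γG : 2 < γP G
    2<γG = ≤-reflexive (sym γG)

    2<γH : 2 < γP H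
    2<γH = ≤-reflexive (sym γH)

    codegree-≥2 : ∀ v w → 2 ≤ codegree c v w
    codegree-≥2 = codegree-≥ c γG γH

  -- The codegrees of `v` add up to at least its degree, plus the codegree with `w`, plus 2 for each
  -- of the nine other vertices; a total of 20 beyond the degree leaves no slack.
  codegree-tight : ∀ {Δ v w} → (∀ u → ∣ N H u ∣ ≤ Δ) → ∣ N H v ∣ * Δ ≤ ∣ N H v ∣ + 20 → w ≢ v → codegree c v w ≤ 2
  codegree-tight {Δ} {v} {w} ≤Δ D*Δ≤ w≢v = ℕ.+-cancelʳ-≤ 18 _ _ (ℕ.+-cancelˡ-≤ ∣ N H v ∣ _ _ (begin
    ∣ N H v ∣ + (codegree c v w + 9 * 2)     ≡⟨ cong (λ k → ∣ N H v ∣ + (codegree c v w + k * 2)) (sym m≡9) ⟩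
    ∣ N H v ∣ + (codegree c v w + m * 2)     ≡⟨ cong (_+ (codegree c v w + m * 2)) (sym (codegree-self c v)) ⟩
    codegree c v v + (codegree c v w + m * 2) ≤⟨ sum-≥-remove₂ (codegree c v) w≢v (λ j _ → codegree-≥2 v j) ⟩
    sum (codegree c v)                       ≤⟨ sum-codegree c v ≤Δ ⟩
    ∣ N H v ∣ * Δ                            ≤⟨ D*Δ≤ ⟩
    ∣ N H v ∣ + 20                           ∎))
    where open ≤-Reasoning

  5-regular-tight : (∀ v → ∣ N H v ∣ ≡ 5) → ∀ {v w} → w ≢ v → codegree c v w ≤ 2
  5-regular-tight D≡5 {v} = codegree-tight (≤-reflexive ∘ D≡5)
    (≤-reflexive (trans (cong (_* 5) (D≡5 v)) (cong (_+ 20) (sym (D≡5 v)))))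

  apart-≢ : ∀ {z x y} → z G.~ x → y H.~ x → z ≢ y
  apart-≢ z~x y~x refl = apart c z~x y~x

  -- `z` and `v` have two common H-neighbours in `p`, and these differ from `x`, `y` and `y′`, which
  -- are G-neighbours of `z`.
  crowded : ∀ {p v z x y y′} → N H v ∩ N H z ⊆ p → x Sub.∈ p → y Sub.∈ p → y ≢ x → y′ Sub.∈ p → y′ ≢ x → y′ ≢ y →
    z G.~ x → z G.~ y → z G.~ y′ → 5 ≤ ∣ p ∣
  crowded {p} {v} {z} {x} {y} {y′} ⊆p x∈ y∈ y≢x y′∈ y′≢x y′≢y z~x z~y z~y′ = begin
    3 + 2                         ≤⟨ ℕ.+-monoʳ-≤ 3 (codegree-≥2 v z) ⟩
    3 + codegree c v z            ≤⟨ ℕ.+-monoʳ-≤ 3 (Sub.p⊆q⇒∣p∣≤∣q∣ far) ⟩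
    3 + ∣ p - x - y - y′ ∣        ≤⟨ s≤s (s≤s (Sub.x∈p⇒∣p-x∣<∣p∣ (Sub.x∈p∧x≢y⇒x∈p-y (Sub.x∈p∧x≢y⇒x∈p-y y′∈ y′≢x) y′≢y))) ⟩
    2 + ∣ p - x - y ∣             ≤⟨ s≤s (Sub.x∈p⇒∣p-x∣<∣p∣ (Sub.x∈p∧x≢y⇒x∈p-y y∈ y≢x)) ⟩
    1 + ∣ p - x ∣                 ≤⟨ Sub.x∈p⇒∣p-x∣<∣p∣ x∈ ⟩
    ∣ p ∣                         ∎
    where
    open ≤-Reasoning
    far : N H v ∩ N H z ⊆ p - x - y - y′
    far {u} u∈ = Sub.x∈p∧x≢y⇒x∈p-y (Sub.x∈p∧x≢y⇒x∈p-y (Sub.x∈p∧x≢y⇒x∈p-y (⊆p u∈) (≢u z~x)) (≢u z~y)) (≢u z~y′)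
      where
      ≢u : ∀ {s} → z G.~ s → u ≢ s
      ≢u z~s refl = apart c z~s (∈N⁻ H (proj₂ (Sub.x∈p∩q⁻ (N H v) (N H z) u∈)))

  neighbor-≢ : ∀ {v x} → x Sub.∈ N H v → x ≢ v
  neighbor-≢ x∈ refl = H.~-irrefl refl (∈N⁻ H x∈)

  -- The vertices `v` and `x` leave exactly `y` and `y′` undominated in `G`.
  Residue : (v x y y′ : Fin (2 + m)) → Set
  Residue v x y y′ = y Sub.∈ N H v ∩ N H x × y′ Sub.∈ N H v ∩ N H x × y′ ≢ y ×
    (∀ {u} → u Sub.∈ N H v ∩ N H x → u ≡ y ⊎ u ≡ y′)

  module _ {v x y y′ : Fin (2 + m)} (x∈v : x Sub.∈ N H v) (residue : Residue v x y y′) where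
    private
      y∈v : y Sub.∈ N H v
      y∈v = Sub.p∩q⊆p (N H v) (N H x) (proj₁ residue)

      y∈x : y Sub.∈ N H x
      y∈x = Sub.p∩q⊆q (N H v) (N H x) (proj₁ residue)

      y′∈v : y′ Sub.∈ N H v
      y′∈v = Sub.p∩q⊆p (N H v) (N H x) (proj₁ (proj₂ residue))

      y′∈x : y′ Sub.∈ N H x
      y′∈x = Sub.p∩q⊆q (N H v) (N H x) (proj₁ (proj₂ residue))

      y′≢y : y′ ≢ y
      y′≢y = proj₁ (proj₂ (proj₂ residue))

      only : ∀ {u} → u Sub.∈ N H v ∩ N H x → u ≡ y ⊎ u ≡ y′
      only = proj₂ (proj₂ (proj₂ residue))

      twins′ : ∀ {z} → z ≢ y → z G.~ y → z ≢ y′ → z G.~ y′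
      twins′ = twins c 2<γG (≤-trans (s≤s (s≤s z≤n)) 2<γH) only

    -- `z` is also G-adjacent to `y′`, the twin of `y`, which makes `crowded` applicable to `N H v`.
    crowded-by-common : ∀ z → z G.~ x → z G.~ y → 5 ≤ ∣ N H v ∣
    crowded-by-common z z~x z~y =
      crowded (Sub.p∩q⊆p (N H v) (N H z)) x∈v y∈v (neighbor-≢ y∈x) y′∈v (neighbor-≢ y′∈x) y′≢y z~x z~y
        (twins′ (λ z≡y → G.~-irrefl z≡y z~y) z~y (apart-≢ z~x (H.~-sym (∈N⁻ H y′∈x))))

    -- `t` is H-adjacent neither to `y` nor, being different from `y` and `y′`, to `x`. So it is
    -- G-adjacent to `x`, `y` and `y′`, and `N H v` contains `t` besides the five vertices given by
    -- `crowded`.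
    crowded-from-within : ∀ t → t Sub.∈ N H v → ¬ t Sub.∈ (⁅ y ⁆ ∪ ⁅ y′ ⁆) ∪ (N H v ∩ N H y) → 5 < ∣ N H v ∣
    crowded-from-within t t∈v t∉ = ≤-trans (s≤s
      (crowded ⊆N-t (Sub.x∈p∧x≢y⇒x∈p-y x∈v (t≢x ∘ sym)) (Sub.x∈p∧x≢y⇒x∈p-y y∈v (t≢y ∘ sym)) (neighbor-≢ y∈x)
        (Sub.x∈p∧x≢y⇒x∈p-y y′∈v (t≢y′ ∘ sym)) (neighbor-≢ y′∈x) y′≢y t~x t~y (twins′ t≢y t~y t≢y′)))
      (Sub.x∈p⇒∣p-x∣<∣p∣ t∈v)
      where
      t≢y : t ≢ y
      t≢y t≡y = t∉ (Sub.x∈p∪q⁺ (inj₁ (Sub.x∈p∪q⁺ (inj₁ (subst (Sub._∈ ⁅ y ⁆) (sym t≡y) (Sub.x∈⁅x⁆ y))))))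

      t≢y′ : t ≢ y′
      t≢y′ t≡y′ = t∉ (Sub.x∈p∪q⁺ (inj₁ (Sub.x∈p∪q⁺ (inj₂ (subst (Sub._∈ ⁅ y′ ⁆) (sym t≡y′) (Sub.x∈⁅x⁆ y′))))))

      t~y : t G.~ y
      t~y = join (⋈-sym c) t≢y λ t~y → t∉ (Sub.x∈p∪q⁺ (inj₂ (Sub.x∈p∩q⁺ (t∈v , ∈N⁺ H (H.~-sym t~y)))))

      t≢x : t ≢ x
      t≢x = apart-≢ t~y (∈N⁻ H y∈x)

      t~x : t G.~ x
      t~x = join (⋈-sym c) t≢x λ t~x → [ t≢y , t≢y′ ]′ (only (Sub.x∈p∩q⁺ (t∈v , ∈N⁺ H (H.~-sym t~x))))

      ⊆N-t : N H v ∩ N H t ⊆ N H v - t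
      ⊆N-t u∈ = let u∈v , u∈t = Sub.x∈p∩q⁻ (N H v) (N H t) u∈ in Sub.x∈p∧x≢y⇒x∈p-y u∈v (neighbor-≢ u∈t)

  -- Degree 4 makes the path count tight, as 4 · 6 = 4 + 20. A common G-neighbour of `x` and `y`,
  -- which exists since two vertices do not dominate `H`, then forces degree at least 5.
  order-11-degree≢4 : ∀ v → ∣ N H v ∣ ≢ 4
  order-11-degree≢4 v D≡4 =
    let x , x∈ = ∣p∣>0⇒nonempty {p = N H v} (≤-trans (s≤s z≤n) (≤-reflexive (sym D≡4)))
        tight = codegree-tight {w = x} (degree-≤ c γG γH {6} (cong suc m≡9))
          (≤-reflexive (trans (cong (_* 6) D≡4) (cong (_+ 20) (sym D≡4)))) (neighbor-≢ x∈)
        y , y′ , residue = pair-elements (codegree-≥2 v x) tight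
        z , z~ = common-neighbor c (⁅ x ⁆ ∪ ⁅ y ⁆) (≤-trans (s≤s (∣⁅x⁆∪⁅y⁆∣≤2 x y)) 2<γH)
    in ℕ.<⇒≱ (s≤s (≤-reflexive D≡4)) (crowded-by-common x∈ residue z
         (z~ x (Sub.x∈p∪q⁺ (inj₁ (Sub.x∈⁅x⁆ x)))) (z~ y (Sub.x∈p∪q⁺ (inj₂ (Sub.x∈⁅x⁆ y)))))

  -- The path count is tight, as 5 · 5 = 5 + 20. The set that `t` must avoid has at most 2 + 2
  -- elements, so one of the five H-neighbours of `v` avoids it, and then the degree exceeds 5.
  order-11-not-5-regular : Fin (2 + m) → ¬ (∀ v → ∣ N H v ∣ ≡ 5)
  order-11-not-5-regular v D≡5 =
    let x , x∈ = ∣p∣>0⇒nonempty {p = N H v} (≤-trans (s≤s z≤n) (≤-reflexive (sym (D≡5 v))))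
        y , y′ , residue = pair-elements (codegree-≥2 v x) (5-regular-tight D≡5 (neighbor-≢ x∈))
        y≢v = neighbor-≢ (Sub.p∩q⊆p (N H v) (N H x) (proj₁ residue))
        few = ≤-trans (∣p∪q∣≤∣p∣+∣q∣ (⁅ y ⁆ ∪ ⁅ y′ ⁆) (N H v ∩ N H y))
          (ℕ.+-mono-≤ (∣⁅x⁆∪⁅y⁆∣≤2 y y′) (5-regular-tight D≡5 y≢v))
        t , t∈v , t∉ = ∣p∣<∣q∣⇒∃ {q = N H v} (≤-trans (s≤s few) (≤-reflexive (sym (D≡5 v))))
    in ℕ.<⇒≱ (crowded-from-within x∈ residue t t∈v t∉) (≤-reflexive (D≡5 v))

-- The upper bound

*3≤⇒≤/3 : ∀ k {n} → k * 3 ≤ n → k ≤ n / 3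
*3≤⇒≤/3 k {n} k*3≤n = ≤-trans (≤-reflexive (sym (m*n/n≡m k 3))) (/-monoˡ-≤ 3 k*3≤n)

order-10-impossible : ∀ {m} {G H : Graph (suc m)} → G ⋈ H → γP G ≡ 3 → γP H ≡ 3 → m ≢ 9
order-10-impossible {m} c γG γH m≡9 = ℕ.<⇒≱ (degree-sum c zero) (≤-trans (≤-reflexive (cong suc m≡9))
  (ℕ.+-mono-≤ (order-10-degree (⋈-sym c) γH γG m≡9 zero) (order-10-degree c γG γH m≡9 zero)))

-- In both graphs `degree-≥` gives degree at least 4, and 4 is excluded. As the two degrees of a
-- vertex add up to at most 10, `H` is 5-regular.
order-11-impossible : ∀ {m} {G H : Graph (2 + m)} → G ⋈ H → γP G ≡ 3 → γP H ≡ 3 → m ≢ 9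
order-11-impossible {m} {G} {H} c γG γH m≡9 = order-11-not-5-regular c γG γH m≡9 zero λ v → ℕ.≤-antisym
  (ℕ.+-cancelˡ-≤ 5 ∣ N H v ∣ 5 (≤-trans (ℕ.+-monoˡ-≤ ∣ N H v ∣ (≥5 (⋈-sym c) γH γG v))
    (≤-trans (ℕ.≤-pred (degree-sum c v)) (≤-reflexive (cong suc m≡9)))))
  (≥5 c γG γH v)
  where
  ≥5 : ∀ {G H : Graph (2 + m)} → G ⋈ H → γP G ≡ 3 → γP H ≡ 3 → ∀ v → 5 ≤ ∣ N H v ∣
  ≥5 c γG γH v = ℕ.≤∧≢⇒< (degree-≥ c γG γH v) (order-11-degree≢4 c γG γH m≡9 v ∘ sym)

-- `r` is the excess of the order over 9 + 3α. Each `δ` is 3 + 2α + r, one less than the degree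
-- bound, and writing `α` as `1 + x` or `2 + x` keeps the coefficients of `k` nonnegative. The
-- smaller `α` are the orders 10, 11 and 14.
critical-impossible : ∀ {m α} r {G H : Graph (2 + m)} → G ⋈ H → γP G ≡ 3 + α → γP H ≡ 3 →
  r ≤ 2 → 2 + m ≢ 14 → m ≢ 7 + α * 3 + r
critical-impossible {α = α} 0 c γG γH _ _ m≡ =
  dense-contradiction c γG γH {δ = 3 + 2 * α} {k = 3 + 8 * α + 2 * (α * α)} (trans (cong suc m≡) (order α)) (trans (cong (λ k → suc k * (2 + α * 2)) m≡) (identity α)) zero
  where
  order : ∀ α → 8 + α * 3 + 0 ≡ 5 + α + (3 + 2 * α)
  order = solve-∀
  identity : ∀ α → (8 + α * 3 + 0) * (2 + α * 2) ≡ 1 + ((1 + (3 + 2 * α)) * (3 + 2 * α) + (3 + 8 * α + 2 * (α * α)))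
  identity = solve-∀
critical-impossible {α = zero} 1 c γG γH _ _ m≡ = order-10-impossible c γG γH (cong suc m≡)
critical-impossible {α = suc x} 1 c γG γH _ _ m≡ =
  dense-contradiction c γG γH {δ = 6 + 2 * x} {k = 5 + 10 * x + 2 * (x * x)} (trans (cong suc m≡) (order x)) (trans (cong (λ k → suc k * (2 + (1 + x) * 2)) m≡) (identity x)) zero
  where
  order : ∀ x → 8 + (1 + x) * 3 + 1 ≡ 5 + (1 + x) + (6 + 2 * x)
  order = solve-∀
  identity : ∀ x → (8 + (1 + x) * 3 + 1) * (2 + (1 + x) * 2) ≡ 1 + ((1 + (6 + 2 * x)) * (6 + 2 * x) + (5 + 10 * x + 2 * (x * x)))
  identity = solve-∀
critical-impossible {α = 0} 2 c γG γH _ _ m≡ = order-11-impossible c γG γH m≡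
critical-impossible {α = 1} 2 _ _ _ _ n≢14 m≡ = n≢14 (cong (2 +_) m≡)
critical-impossible {α = suc (suc x)} 2 c γG γH _ _ m≡ =
  dense-contradiction c γG γH {δ = 9 + 2 * x} {k = 5 + 12 * x + 2 * (x * x)} (trans (cong suc m≡) (order x)) (trans (cong (λ k → suc k * (2 + (2 + x) * 2)) m≡) (identity x)) zero
  where
  order : ∀ x → 8 + (2 + x) * 3 + 2 ≡ 5 + (2 + x) + (9 + 2 * x)
  order = solve-∀
  identity : ∀ x → (8 + (2 + x) * 3 + 2) * (2 + (2 + x) * 2) ≡ 1 + ((1 + (9 + 2 * x)) * (9 + 2 * x) + (5 + 12 * x + 2 * (x * x)))
  identity = solve-∀
critical-impossible (suc (suc (suc _))) _ _ _ (s≤s (s≤s ()))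

module _ {n : ℕ} where

  NordhausGaddum : Graph n → Graph n → Set
  NordhausGaddum G H =
    (n ∉ exceptionalOrders → γP G + γP H ≤ n / 3 + 2) ×
    (n ∈ exceptionalOrders → γP G + γP H ≤ n / 3 + 3)

  NordhausGaddum-sym : ∀ {G H} → NordhausGaddum G H → NordhausGaddum H G
  NordhausGaddum-sym {G} {H} (ord , exc) =
    ≤-trans (≤-reflexive (ℕ.+-comm (γP H) (γP G))) ∘ ord ,
    ≤-trans (≤-reflexive (ℕ.+-comm (γP H) (γP G))) ∘ exc

  γP≤2-case : ∀ {G H} → γP G * 3 ≤ n → γP H ≤ 2 → NordhausGaddum G H
  γP≤2-case {G} 3γ≤n ≤2 =
    (λ _ → ℕ.+-mono-≤ (*3≤⇒≤/3 (γP G) 3γ≤n) ≤2) ,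
    (λ _ → ℕ.+-mono-≤ (*3≤⇒≤/3 (γP G) 3γ≤n) (≤-trans ≤2 (ℕ.n≤1+n 2)))

  -- Adds the degree bounds in both graphs, and one for the vertex itself.
  order-≥ : ∀ {G H α β} → G ⋈ H → γP G ≡ 3 + α → γP H ≡ 3 + β → Fin n → 9 + (α + β) * 3 + 2 * (α * β) ≤ n
  order-≥ {α = α} {β} c γG γH v = ≤-trans (≤-reflexive (identity α β))
    (≤-trans (s≤s (ℕ.+-mono-≤ (degree-≥ (⋈-sym c) γH γG v) (degree-≥ c γG γH v))) (degree-sum c v))
    where
    identity : ∀ α β → 9 + (α + β) * 3 + 2 * (α * β) ≡ 1 + ((2 + (1 + β) * (2 + α)) + (2 + (1 + α) * (2 + β)))
    identity = solve-∀

  bound : ∀ {G H : Graph n} k s {α β} → γP G ≡ 3 + α → γP H ≡ 3 + β → 6 + (α + β) ≡ k + s → k * 3 ≤ n → γP G + γP H ≤ n / 3 + s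
  bound {G} {H} k s {α} {β} γG γH eq k*3≤n = begin
    γP G + γP H            ≡⟨ cong₂ _+_ γG γH ⟩
    (3 + α) + (3 + β)      ≡⟨ identity α β ⟩
    6 + (α + β)            ≡⟨ eq ⟩
    k + s                  ≤⟨ ℕ.+-monoˡ-≤ s (*3≤⇒≤/3 k k*3≤n) ⟩
    n / 3 + s              ∎
    where
    open ≤-Reasoning
    identity : ∀ α β → (3 + α) + (3 + β) ≡ 6 + (α + β)
    identity = solve-∀

  -- Valid for every order: without the term `2 * (α * β)`, `order-≥` says that three times
  -- `3 + (α + β)` is at most `n`.
  exceptional-bound : ∀ {G H α β} → G ⋈ H → γP G ≡ 3 + α → γP H ≡ 3 + β → Fin n → γP G + γP H ≤ n / 3 + 3
  exceptional-bound {α = α} {β} c γG γH v = bound (3 + (α + β)) 3 γG γH (cong (3 +_) (ℕ.+-comm 3 (α + β)))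
    (≤-trans (ℕ.m≤m+n (9 + (α + β) * 3) (2 * (α * β))) (order-≥ c γG γH v))

  γH≡3-case : ∀ {G H α} → G ⋈ H → γP G ≡ 3 + α → γP H ≡ 3 → Fin n → n ∉ exceptionalOrders → (4 + α) * 3 ≤ n
  γH≡3-case {G} {H} {α} c γG γH v n∉ = ℕ.≮⇒≥ (go c γG γH 9+3α≤n n∉)
    where
    9+3α≤n : 9 + α * 3 ≤ n
    9+3α≤n = ≤-trans (≤-reflexive (identity α)) (order-≥ c γG γH v)
      where
      identity : ∀ α → 9 + α * 3 ≡ 9 + (α + 0) * 3 + 2 * (α * 0)
      identity = solve-∀

    -- `n` becomes a variable to be matched as `2 + m`; the bounds leave an excess of at most 2 over
    -- 9 + 3α.
    go : ∀ {n} {G H : Graph n} → G ⋈ H → γP G ≡ 3 + α → γP H ≡ 3 → 9 + α * 3 ≤ n → n ∉ exceptionalOrders → ¬ n < 12 + α * 3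
    go {suc zero} _ _ _ (s≤s ())
    go {suc (suc m)} c γG γH n≥ n∉ n< = critical-impossible (m ∸ (7 + α * 3)) c γG γH
      (≤-trans (ℕ.∸-monoˡ-≤ (7 + α * 3) (ℕ.≤-pred (ℕ.≤-pred (ℕ.≤-pred n<)))) (≤-reflexive (ℕ.m+n∸n≡m 2 (7 + α * 3))))
      (λ n≡14 → n∉ (there (here n≡14)))
      (sym (ℕ.m+[n∸m]≡n (ℕ.≤-pred (ℕ.≤-pred n≥))))

  -- n ≥ 17 + 5(x + y) + 2xy here, so only n = 17 with x = y = 0 escapes.
  γ≥4-case : ∀ x y → 9 + ((1 + x) + (1 + y)) * 3 + 2 * ((1 + x) * (1 + y)) ≤ n → n ∉ exceptionalOrders →
    (4 + ((1 + x) + (1 + y))) * 3 ≤ n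
  γ≥4-case zero zero n≥ n∉ = ℕ.≤∧≢⇒< n≥ λ { refl → n∉ (there (there (there (here refl)))) }
  γ≥4-case (suc x) y n≥ _ = ≤-trans (≤-trans (ℕ.m≤m+n _ (1 + 2 * x + 4 * y + 2 * (x * y))) (≤-reflexive (identity x y))) n≥
    where
    identity : ∀ x y → (4 + ((1 + (1 + x)) + (1 + y))) * 3 + (1 + 2 * x + 4 * y + 2 * (x * y)) ≡
      9 + ((1 + (1 + x)) + (1 + y)) * 3 + 2 * ((1 + (1 + x)) * (1 + y))
    identity = solve-∀
  γ≥4-case zero (suc y) n≥ _ = ≤-trans (≤-trans (ℕ.m≤m+n _ (1 + 2 * y)) (≤-reflexive (identity y))) n≥
    where
    identity : ∀ y → (4 + (1 + (1 + (1 + y)))) * 3 + (1 + 2 * y) ≡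
      9 + (1 + (1 + (1 + y))) * 3 + 2 * (1 * (1 + (1 + y)))
    identity = solve-∀

  γP≥3-case : ∀ {G H} α β → G ⋈ H → γP G ≡ 3 + α → γP H ≡ 3 + β → Fin n → NordhausGaddum G H
  γP≥3-case {G} {H} α β c γG γH v = ordinary α β γG γH , λ _ → exceptional-bound c γG γH v
    where
    6+≡4++2 : ∀ k → 6 + k ≡ 4 + k + 2
    6+≡4++2 = solve-∀

    ordinary : ∀ α β → γP G ≡ 3 + α → γP H ≡ 3 + β → n ∉ exceptionalOrders → γP G + γP H ≤ n / 3 + 2
    ordinary α zero γG γH n∉ = bound (4 + α) 2 γG γH (trans (cong (6 +_) (ℕ.+-identityʳ α)) (6+≡4++2 α)) (γH≡3-case c γG γH v n∉)
    ordinary zero (suc β) γG γH n∉ = bound (4 + suc β) 2 γG γH (6+≡4++2 (suc β)) (γH≡3-case (⋈-sym c) γH γG v n∉)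
    ordinary (suc x) (suc y) γG γH n∉ = bound (4 + (suc x + suc y)) 2 γG γH (6+≡4++2 (suc x + suc y)) (γ≥4-case x y (order-≥ c γG γH v) n∉)

  nordhaus-gaddum : ∀ {G H} → G ⋈ H → γP G * 3 ≤ n → γP H * 3 ≤ n → Fin n → NordhausGaddum G H
  nordhaus-gaddum {G} {H} c 3γG≤n 3γH≤n v with γP G ≤? 2 | γP H ≤? 2
  ... | _      | yes ≤2 = γP≤2-case {G} {H} 3γG≤n ≤2
  ... | yes ≤2 | no _   = NordhausGaddum-sym {H} {G} (γP≤2-case {H} {G} 3γH≤n ≤2)
  ... | no 2≱  | no 2≱′ = γP≥3-case (γP G ∸ 3) (γP H ∸ 3) c
    (sym (ℕ.m+[n∸m]≡n (ℕ.≰⇒> 2≱))) (sym (ℕ.m+[n∸m]≡n (ℕ.≰⇒> 2≱′))) v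

-- Sharpness

other : ∀ {r} → 2 ≤ r → (i : Fin r) → ∃ λ j → j ≢ i
other (s≤s (s≤s z≤n)) zero    = suc zero , λ ()
other (s≤s (s≤s z≤n)) (suc _) = zero , λ ()

third : (a b : Fin 3) → ∃ λ d → d ≢ a × d ≢ b
third zero            zero            = suc zero , (λ ()) , (λ ())
third zero            (suc zero)      = suc (suc zero) , (λ ()) , (λ ())
third zero            (suc (suc zero)) = suc zero , (λ ()) , (λ ())
third (suc zero)      zero            = suc (suc zero) , (λ ()) , (λ ())
third (suc zero)      (suc b)         = zero , (λ ()) , (λ ())
third (suc (suc zero)) zero           = suc zero , (λ ()) , (λ ())
third (suc (suc zero)) (suc b)        = zero , (λ ()) , (λ ())

module _ (r : ℕ) (2≤r : 2 ≤ r) where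
  private
    G : Graph (r * 3)
    G = rK₃ r 2≤r

    Ḡ : Graph (r * 3)
    Ḡ = complement G

    module G = Graph G
    module Ḡ = Graph Ḡ

    copy : Fin (r * 3) → Fin r
    copy u = proj₁ (remQuot {r} 3 u)

    vertex : Fin (r * 3) → Fin 3
    vertex u = proj₂ (remQuot {r} 3 u)

    copy-combine : ∀ i a → copy (combine i a) ≡ i
    copy-combine i a = cong proj₁ (Fin.remQuot-combine {r} i a)

    vertex-combine : ∀ i a → vertex (combine i a) ≡ a
    vertex-combine i a = cong proj₂ (Fin.remQuot-combine {r} i a)

    copy-vertex-injective : ∀ {u v} → copy u ≡ copy v → vertex u ≡ vertex v → u ≡ v
    copy-vertex-injective {u} {v} c≡ a≡ = trans (sym (Fin.combine-remQuot {r} 3 u))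
      (trans (cong₂ combine c≡ a≡) (Fin.combine-remQuot {r} 3 v))

    copy⊆⇒3≤ : ∀ (i : Fin r) {p : Subset (r * 3)} → (∀ a → combine i a Sub.∈ p) → 3 ≤ ∣ p ∣
    copy⊆⇒3≤ i = injection-≤ (combine i) (λ {a} {b} → Fin.combine-injectiveʳ i a i b)

  rK₃-components : EveryComponentHasOrder≥ 3 G
  rK₃-components H comp = let v , v∈H = Subgraph.nonempty H in copy⊆⇒3≤ (copy v) (mate v v∈H)
    where
    mate : ∀ v → v Sub.∈ Subgraph.vertices H → ∀ a → combine (copy v) a Sub.∈ Subgraph.vertices H
    mate v v∈H a with vertex v Fin.≟ a
    ... | yes refl = subst (Sub._∈ Subgraph.vertices H) (sym (Fin.combine-remQuot {r} 3 v)) v∈H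
    ... | no v≢a = component-closed G {H} comp v∈H
      (sym (copy-combine (copy v) a) , λ v≡a → v≢a (trans v≡a (vertex-combine (copy v) a)))

  -- A vertex is adjacent in the complement to all three vertices of any other triangle.
  rK₃-complement-components : EveryComponentHasOrder≥ 3 Ḡ
  rK₃-complement-components H comp =
    let v , v∈H = Subgraph.nonempty H
        j , j≢ = other 2≤r (copy v)
        copy≢ : ∀ a → copy v ≢ copy (combine j a)
        copy≢ a eq = j≢ (trans (sym (copy-combine j a)) (sym eq))
    in copy⊆⇒3≤ j λ a → component-closed Ḡ {H} comp v∈H ((λ v≡ → copy≢ a (cong copy v≡)) , λ (c≡ , _) → copy≢ a c≡)

  -- A power dominating set meets every triangle: no edge leaves a triangle, so the vertices outside
  -- an unmet one form a forcing-closed set that contains all dominated vertices.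
  r≤γP-rK₃ : r ≤ γP G
  r≤γP-rK₃ = ≤γP G r λ S pd → injection-≤ (λ i → proj₁ (meets S pd i))
    (λ {i} {j} eq → trans (sym (proj₂ (proj₂ (meets S pd i)))) (trans (cong copy eq) (proj₂ (proj₂ (meets S pd j)))))
    (λ i → proj₁ (proj₂ (meets S pd i)))
    where
    meets : ∀ S → IsPowerDominating G S → ∀ i → ∃ λ v → v Sub.∈ S × copy v ≡ i
    meets S pd i with Fin.any? (λ v → (v ∈? S) ×-dec (copy v Fin.≟ i))
    ... | yes found = found
    ... | no none = contradiction
      (isPowerDominating⁻ G {Q = ⟪ outside? ⟫} pd
        (λ v∈ p∉ (c≡ , _) → contradiction (∈⟪⟫⁺ outside? (λ p≡i → ∈⟪⟫⁻ outside? v∈ (trans c≡ p≡i))) p∉)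
        (λ { (s , s∈S , inj₁ refl)     → ∈⟪⟫⁺ outside? λ s≡i → none (s , s∈S , s≡i)
           ; (s , s∈S , inj₂ (c≡ , _)) → ∈⟪⟫⁺ outside? λ x≡i → none (s , s∈S , trans c≡ x≡i) })
        (combine i zero))
      λ in-Q → ∈⟪⟫⁻ outside? in-Q (copy-combine i zero)
      where
      outside? : Decidable (λ u → copy u ≢ i)
      outside? u = ¬? (copy u Fin.≟ i)

  -- The two other vertices of a triangle are twins in the complement, so from
  -- a single vertex of it neither is ever forced.
  2≤γP-complement : 2 ≤ γP Ḡ
  2≤γP-complement = ≤γP Ḡ 2 λ S pd → ℕ.≰⇒> λ few → impossible pd (base few)
    where
    base : ∀ {S} → ∣ S ∣ ≤ 1 → ∃ λ v → ∀ {s} → s Sub.∈ S → s ≡ v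
    base {S} few with Sub.nonempty? S
    ... | yes (v , v∈S) = v , λ s∈S → ∣p∣≤1⁻ few s∈S v∈S
    -- An empty `S` allows any `v`; `2≤r`, read as `1 < r`, supplies a triangle.
    ... | no none       = combine (fromℕ< 2≤r) zero , λ {s} s∈S → contradiction (s , s∈S) none

    impossible : ∀ {S} → IsPowerDominating Ḡ S → ¬ (∃ λ v → ∀ {s} → s Sub.∈ S → s ≡ v)
    impossible {S} pd (v , only) = ∈⟪⟫⁻ far? (isPowerDominating⁻ Ḡ pd closed dom mate)
      (sym (copy-combine (copy v) d) , λ v≡d → d≢v (sym (trans v≡d (vertex-combine (copy v) d))))
      where
      far? : Decidable (λ u → ¬ v G.~ u)
      far? u = ¬? (v G.~? u)

      d : Fin 3
      d = proj₁ (third (vertex v) (vertex v))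

      d≢v : d ≢ vertex v
      d≢v = proj₁ (proj₂ (third (vertex v) (vertex v)))

      mate : Fin (r * 3)
      mate = combine (copy v) d

      dom : ∀ {x} → Dominates Ḡ S x → x Sub.∈ ⟪ far? ⟫
      dom (s , s∈S , d) with only s∈S
      dom (s , s∈S , inj₁ refl)      | refl = ∈⟪⟫⁺ far? (G.~-irrefl refl)
      dom (s , s∈S , inj₂ (_ , v≁x)) | refl = ∈⟪⟫⁺ far? v≁x

      closed : ForcingClosed Ḡ ⟪ far? ⟫
      closed {z} {p} _ p∉ (z≢p , z≁p) =
        p′ , (λ p′≡p → proj₁ (proj₂ b) (trans (sym (vertex-combine (copy v) (proj₁ b))) (cong vertex p′≡p)))
           , (λ p′∈ → ∈⟪⟫⁻ far? p′∈ v~p′)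
           , (λ z≡p′ → copy≢ (trans (cong copy z≡p′) copy-p′)) , λ (c≡ , _) → copy≢ (trans c≡ copy-p′)
        where
        v~p : v G.~ p
        v~p = decidable-stable (v G.~? p) (p∉ ∘ ∈⟪⟫⁺ far?)

        b : ∃ λ b → b ≢ vertex p × b ≢ vertex v
        b = third (vertex p) (vertex v)

        p′ : Fin (r * 3)
        p′ = combine (copy v) (proj₁ b)

        copy-p′ : copy p′ ≡ copy v
        copy-p′ = copy-combine (copy v) (proj₁ b)

        v~p′ : v G.~ p′
        v~p′ = sym copy-p′ , λ v≡b → proj₂ (proj₂ b) (sym (trans v≡b (vertex-combine (copy v) (proj₁ b))))

        -- In the triangle of `v`, `z` would equal `p` or be G-adjacent to it; from outside, `z` is
        -- adjacent in the complement to `p` and `p′` alike.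
        copy≢ : copy z ≢ copy v
        copy≢ c≡ = z≁p (trans c≡ (proj₁ v~p) , λ a≡ → z≢p (copy-vertex-injective (trans c≡ (proj₁ v~p)) a≡))

-- No exceptional order is a multiple of 3. From `r = 7` on, `r * 3` exceeds 20; unification refutes
-- every equation.
r*3-not-exceptional : ∀ r → r * 3 ∉ exceptionalOrders
r*3-not-exceptional 0 = λ { (there (there (there (there (there ()))))) }
r*3-not-exceptional 1 = λ { (there (there (there (there (there ()))))) }
r*3-not-exceptional 2 = λ { (there (there (there (there (there ()))))) }
r*3-not-exceptional 3 = λ { (there (there (there (there (there ()))))) }
r*3-not-exceptional 4 = λ { (there (there (there (there (there ()))))) }
r*3-not-exceptional 5 = λ { (there (there (there (there (there ()))))) }
r*3-not-exceptional 6 = λ { (there (there (there (there (there ()))))) }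
r*3-not-exceptional (suc (suc (suc (suc (suc (suc (suc r))))))) = λ { (there (there (there (there (there ()))))) }

theorem3p2 : (∀ (n : ℕ) (G : Graph n) →
    EveryComponentHasOrder≥ 3 G →
    EveryComponentHasOrder≥ 3 (complement G) →
    (n ∉ exceptionalOrders → γP G + γP (complement G) ≤ n / 3 + 2) ×
    (n ∈ exceptionalOrders → γP G + γP (complement G) ≤ n / 3 + 3))
    ×
    (∀ (r : ℕ) (2≤r : 2 ≤ r) →
    EveryComponentHasOrder≥ 3 (rK₃ r 2≤r) ×
    EveryComponentHasOrder≥ 3 (complement (rK₃ r 2≤r)) ×
    r * 3 ∉ exceptionalOrders ×
    γP (rK₃ r 2≤r) + γP (complement (rK₃ r 2≤r)) ≡ (r * 3) / 3 + 2)
theorem3p2 = upper , sharp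
  where
  upper : ∀ n (G : Graph n) → EveryComponentHasOrder≥ 3 G → EveryComponentHasOrder≥ 3 (complement G) →
    NordhausGaddum G (complement G)
  upper n G big bigᶜ = nordhaus-gaddum (⋈-complement G) (3*γP≤n G big) (3*γP≤n (complement G) bigᶜ)
    (fromℕ< (Graph.nonempty G))

  sharp : ∀ r 2≤r → _
  sharp r 2≤r = big , bigᶜ , r*3-not-exceptional r , ℕ.≤-antisym
    -- As 3r is not exceptional, the upper bound just proved applies to `rK₃` itself.
    (proj₁ (upper (r * 3) (rK₃ r 2≤r) big bigᶜ) (r*3-not-exceptional r))
    (≤-trans (≤-reflexive (cong (_+ 2) (m*n/n≡m r 3))) (ℕ.+-mono-≤ (r≤γP-rK₃ r 2≤r) (2≤γP-complement r 2≤r)))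
    where
    big : EveryComponentHasOrder≥ 3 (rK₃ r 2≤r)
    big = rK₃-components r 2≤r

    bigᶜ : EveryComponentHasOrder≥ 3 (complement (rK₃ r 2≤r))
    bigᶜ = rK₃-complement-components r 2≤r
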